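{- There exists a constant $\beta > 0$ such that for every sufficiently large integer $k$ the following holds: every simple Eulerian digraph with minimum in-degree (and out-degree) at least $100k$ immerses a simple digraph with at most $\beta k$ vertices and at least $k^2/2$ edges.
   Context: A simple digraph has no loops and at most one copy of the edge $xy$ for each ordered pair $(x,y)$ (both $xy$ and $yx$ may be present). A digraph is Eulerian if every vertex has in-degree equal to out-degree. A digraph $G$ immerses $H$ if there is an injective $f:V(H)\to V(G)$ and pairwise edge-disjoint directed paths $P_e$ in $G$, one per edge $e=uv$ of $H$, from $f(u)$ to $f(v)$. -}

module Defs where

open import Data.Nat using (ℕ; zero; suc; _+_; _*_; _≤_; _<_)
open import Data.Bool using (Bool; true; false; if_then_else_)
open import Data.Fin using (Fin)
import Data.Fin as F
open import Data.Product using (Σ; _×_; _,_)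
open import Data.List using (List; []; _∷_)
open import Data.List.Membership.Propositional using (_∈_)
open import Data.List.Relation.Unary.Unique.Propositional using (Unique)
open import Relation.Binary.PropositionalEquality using (_≡_)
open import Relation.Nullary using (¬_)
open import Function.Definitions using (Injective)

countT : ∀ {n} → (Fin n → Bool) → ℕ
countT {zero}  p = 0
countT {suc n} p = (if p F.zero then 1 else 0) + countT (λ i → p (F.suc i))

record Digraph : Set where
  field
    n        : ℕ
    adj      : Fin n → Fin n → Bool
    loopless : ∀ v → adj v v ≡ false
open Digraph public

Edge : (G : Digraph) → Fin (n G) → Fin (n G) → Set
Edge G x y = adj G x y ≡ true

outdeg : (G : Digraph) → Fin (n G) → ℕ
outdeg G v = countT (λ w → adj G v w)

indeg : (G : Digraph) → Fin (n G) → ℕ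
indeg G v = countT (λ w → adj G w v)

edgeCount : Digraph → ℕ
edgeCount G = go (n G) (λ u → outdeg G u)
  where
  go : (m : ℕ) → (Fin m → ℕ) → ℕ
  go zero    f = 0
  go (suc m) f = f F.zero + go m (λ i → f (F.suc i))

Eulerian : Digraph → Set
Eulerian G = ∀ v → indeg G v ≡ outdeg G v

data Walk (G : Digraph) : Fin (n G) → Fin (n G) → Set where
  stop : ∀ {x} → Walk G x x
  step : ∀ {x y z} → Edge G x y → Walk G y z → Walk G x z

walkVertices : ∀ {G x y} → Walk G x y → List (Fin (n G))
walkVertices {x = x} stop       = x ∷ []
walkVertices {x = x} (step _ w) = x ∷ walkVertices w

walkEdges : ∀ {G x y} → Walk G x y → List (Fin (n G) × Fin (n G))
walkEdges stop                       = []
walkEdges {x = x} (step {y = y} _ w) = (x , y) ∷ walkEdges w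

record Path (G : Digraph) (x y : Fin (n G)) : Set where
  field
    walk     : Walk G x y
    distinct : Unique (walkVertices walk)
open Path public

pathEdges : ∀ {G x y} → Path G x y → List (Fin (n G) × Fin (n G))
pathEdges P = walkEdges (walk P)

Immerses : Digraph → Digraph → Set
Immerses G H =
  Σ (Fin (n H) → Fin (n G)) λ f →
  Injective _≡_ _≡_ f ×
  Σ ((u v : Fin (n H)) → Edge H u v → Path G (f u) (f v)) λ P →
  ∀ u v u' v' (e : Edge H u v) (e' : Edge H u' v') →
  ¬ ((u , v) ≡ (u' , v')) →
  ∀ a b → (a , b) ∈ pathEdges (P u v e) → ¬ ((a , b) ∈ pathEdges (P u' v' e'))

{-# OPTIONS --safe #-}
module Submission where

open import Defs
open import Data.Nat using (ℕ; _+_; _*_; _≤_; _<_)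
open import Data.Product using (Σ; _×_)
open import Data.Product using (∃; _,_; proj₁; proj₂)
open import Data.Product.Properties using (≡-dec)
open import Data.Nat using (zero; suc; pred; z≤n; s≤s; s≤s⁻¹; _≤?_; _<?_; >-nonZero)
open import Data.Nat.Properties hiding (_≟_)
open import Data.Nat.Induction using (<-wellFounded)
open import Data.Nat.Tactic.RingSolver using (solve-∀)
open import Data.Bool using (Bool; true; false; if_then_else_)
import Data.Bool.Properties as Bool
open import Data.Fin using (Fin; zero; suc; fromℕ<)
import Data.Fin.Properties as Fin
open import Data.Empty using (⊥-elim)
open import Data.Sum using (_⊎_; inj₁; inj₂; [_,_]′)
open import Data.List using (List; []; _∷_; _++_; map; length; lookup; replicate; filter; take; allFin; tabulate; cartesianProduct)
open import Data.List.Properties using (++-assoc; length-map; length-take)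
open import Data.List.Relation.Unary.Any using (here; there; any?)
open import Data.List.Relation.Unary.All using (All; []; _∷_; all?)
import Data.List.Relation.Unary.All as All
open import Data.List.Relation.Unary.All.Properties using (¬All⇒Any¬)
open import Data.List.Relation.Unary.AllPairs using ([]; _∷_)
open import Data.List.Relation.Unary.Unique.Propositional using (Unique)
open import Data.List.Relation.Unary.Unique.Propositional.Properties using (filter⁺; take⁺; allFin⁺; cartesianProduct⁺)
open import Data.List.Relation.Binary.Permutation.Propositional using (_↭_; refl; prep; swap; ↭-refl; ↭-sym; ↭-trans; ↭-reflexive; ↭⇒↭ₛ) renaming (trans to step↭)
open import Data.List.Relation.Binary.Permutation.Propositional.Properties using (∈-resp-↭; All-resp-↭; ↭-length; shift; shifts; ++⁺ʳ; ++⁺ˡ)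
import Data.List.Relation.Binary.Permutation.Setoid.Properties as Permₛ
open import Data.List.Membership.Propositional using (_∈_; _∉_; find; lose)
open import Data.List.Membership.Propositional.Properties using (∈-∃++; ∈-++⁺ˡ; ∈-++⁺ʳ; ∈-++⁻; ∈-lookup; ∈-map⁺; ∈-map⁻; ∈-filter⁺; ∈-filter⁻; ∈-allFin; ∈-cartesianProduct⁺)
open import Function using (_∘_; const; id)
open import Induction.WellFounded using (Acc; acc)
open import Relation.Nullary using (¬_; Dec; yes; no)
open import Relation.Nullary.Decidable using (_×-dec_; ¬?)
open import Relation.Unary using (Decidable)
open import Relation.Binary.Definitions using (DecidableEquality)
open import Relation.Binary.PropositionalEquality using (_≡_; _≢_; refl; sym; trans; cong; cong₂; subst; setoid; module ≡-Reasoning)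

-- If deg z > 100 k, lift some x → z → y to a new edge x → y; this fails only if N⁻(z) × N⁺(z) is complete,
-- which is dense. So G may be taken 100 k-regular. Then eliminate the vertices one at a time, joining the
-- in-edges of v to its out-edges: this keeps the degrees but creates parallel edges and loops, whose convex
-- penalty Φ has to stay O(k) per vertex. Choose the pairing at v so that no swap of two of its pairs lowers Φ.
-- Averaging the swap inequalities bounds the new penalty by that of a random pairing, Σ p r g / d, where
-- p and r are the multiplicities at v and g is the marginal cost of one more edge x → y. Unless N⁻(v) × N⁺(v)
-- is dense, the pairs with p and r both small contribute little, and for a fixed x the fixed degree prevents
-- x from having many parallel edges to all out-neighbours of v. So an above-average vertex loses more than
-- it creates, and Φ / n stays bounded. Once 200 k vertices are left, Φ = O(k n) forces ≥ 98 k n distinct edges.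

-- Finite sums and the penalty of parallel edges

-- The balance is delicate. Bounding every marginal cost by 6 in the averaged inequality shows,
-- loops aside, only that the new penalty is at most the penalty removed with v plus an error: the
-- two sides break even. A strict gain has to come from the fixed degree D, which yields smaller row
-- sums when v has few loops, up to terms that can be absorbed. The gain must reach 2 k, the share
-- of the budget that is lost with each vertex. Loops are the other obstacle: a stable pairing may
-- contain them, and a vertex with loops has fewer edges left to pair when its turn comes. Their
-- cost 7 confines them to a single vertex. If v itself has few loops, stability lets a new loop
-- appear only when the penalty removed is so large that a possible loss in the next elimination is
-- paid in advance.

≤-witness : ∀ {m n} k → n ≡ m + k → m ≤ n
≤-witness {m} k eq = ≤-trans (m≤m+n m k) (≤-reflexive (sym eq))

∑ : ∀ {A : Set} → List A → (A → ℕ) → ℕ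
∑ []       f = 0
∑ (x ∷ xs) f = f x + ∑ xs f

module _ {A : Set} where

  ∑-cong∈ : ∀ xs {f g : A → ℕ} → (∀ x → x ∈ xs → f x ≡ g x) → ∑ xs f ≡ ∑ xs g
  ∑-cong∈ []       h = refl
  ∑-cong∈ (x ∷ xs) h = cong₂ _+_ (h x (here refl)) (∑-cong∈ xs (λ y m → h y (there m)))

  ∑-cong : ∀ xs {f g : A → ℕ} → (∀ x → f x ≡ g x) → ∑ xs f ≡ ∑ xs g
  ∑-cong xs h = ∑-cong∈ xs (λ x _ → h x)

  ∑-mono∈ : ∀ xs {f g : A → ℕ} → (∀ x → x ∈ xs → f x ≤ g x) → ∑ xs f ≤ ∑ xs g
  ∑-mono∈ []       h = z≤n
  ∑-mono∈ (x ∷ xs) h = +-mono-≤ (h x (here refl)) (∑-mono∈ xs (λ y m → h y (there m)))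

  ∑-mono : ∀ xs {f g : A → ℕ} → (∀ x → f x ≤ g x) → ∑ xs f ≤ ∑ xs g
  ∑-mono xs h = ∑-mono∈ xs (λ x _ → h x)

  ∑-+ : ∀ xs (f g : A → ℕ) → ∑ xs (λ x → f x + g x) ≡ ∑ xs f + ∑ xs g
  ∑-+ []       f g = refl
  ∑-+ (x ∷ xs) f g = trans (cong (f x + g x +_) (∑-+ xs f g)) (interchange (f x) (g x) (∑ xs f) (∑ xs g))
    where
    interchange : ∀ a b c d → a + b + (c + d) ≡ a + c + (b + d)
    interchange = solve-∀

  ∑-*ˡ : ∀ xs c (f : A → ℕ) → ∑ xs (λ x → c * f x) ≡ c * ∑ xs f
  ∑-*ˡ []       c f = sym (*-zeroʳ c)
  ∑-*ˡ (x ∷ xs) c f = trans (cong (c * f x +_) (∑-*ˡ xs c f)) (sym (*-distribˡ-+ c (f x) (∑ xs f)))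

  ∑-*ʳ : ∀ xs (f : A → ℕ) c → ∑ xs (λ x → f x * c) ≡ ∑ xs f * c
  ∑-*ʳ xs f c = trans (∑-cong xs (λ x → *-comm (f x) c)) (trans (∑-*ˡ xs c f) (*-comm c (∑ xs f)))

  ∑-const : ∀ (xs : List A) c → ∑ xs (λ _ → c) ≡ length xs * c
  ∑-const []       c = refl
  ∑-const (x ∷ xs) c = cong (c +_) (∑-const xs c)

  ∑-zero : ∀ (xs : List A) → ∑ xs (λ _ → 0) ≡ 0
  ∑-zero xs = trans (∑-const xs 0) (*-zeroʳ (length xs))

  ∑-++ : ∀ xs ys (f : A → ℕ) → ∑ (xs ++ ys) f ≡ ∑ xs f + ∑ ys f
  ∑-++ []       ys f = refl
  ∑-++ (x ∷ xs) ys f = trans (cong (f x +_) (∑-++ xs ys f)) (sym (+-assoc (f x) (∑ xs f) (∑ ys f)))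

  ∑-↭ : ∀ {xs ys} (f : A → ℕ) → xs ↭ ys → ∑ xs f ≡ ∑ ys f
  ∑-↭ f refl = refl
  ∑-↭ f (prep x p) = cong (f x +_) (∑-↭ f p)
  ∑-↭ f (swap x y p) = trans (cong (λ t → f x + (f y + t)) (∑-↭ f p)) (exchange (f x) (f y) _)
    where
    exchange : ∀ a b c → a + (b + c) ≡ b + (a + c)
    exchange = solve-∀
  ∑-↭ f (step↭ p q) = trans (∑-↭ f p) (∑-↭ f q)

  term≤∑ : ∀ {x xs} (f : A → ℕ) → x ∈ xs → f x ≤ ∑ xs f
  term≤∑ f (here refl) = m≤m+n _ _
  term≤∑ f (there m)   = ≤-trans (term≤∑ f m) (m≤n+m _ _)

∑-map : ∀ {A B : Set} (h : A → B) xs (f : B → ℕ) → ∑ (map h xs) f ≡ ∑ xs (f ∘ h)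
∑-map h []       f = refl
∑-map h (x ∷ xs) f = cong (f (h x) +_) (∑-map h xs f)

∑-comm : ∀ {A B : Set} xs ys (f : A → B → ℕ) →
         ∑ xs (λ x → ∑ ys (λ y → f x y)) ≡ ∑ ys (λ y → ∑ xs (λ x → f x y))
∑-comm []       ys f = sym (∑-zero ys)
∑-comm (x ∷ xs) ys f = trans (cong (∑ ys (f x) +_) (∑-comm xs ys f)) (sym (∑-+ ys (f x) _))

-- The penalty of a pair joined by w parallel edges off the diagonal is φ w = s 0 + … + s (w − 1);
-- the complement c w = 6 w − φ w stays bounded.

s : ℕ → ℕ
s 0 = 0
s 1 = 2
s 2 = 4
s (suc (suc (suc _))) = 6

φ : ℕ → ℕ
φ zero    = 0
φ (suc w) = s w + φ w

c : ℕ → ℕ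
c 0 = 0
c 1 = 6
c 2 = 10
c (suc (suc (suc _))) = 12

φ-large : ∀ m → φ (3 + m) ≡ 6 + 6 * m
φ-large zero    = refl
φ-large (suc m) = trans (cong (6 +_) (φ-large m)) (lem m)
  where
  lem : ∀ m → 6 + (6 + 6 * m) ≡ 6 + 6 * suc m
  lem = solve-∀

c+φ : ∀ w → c w + φ w ≡ 6 * w
c+φ 0 = refl
c+φ 1 = refl
c+φ 2 = refl
c+φ (suc (suc (suc m))) = trans (cong (12 +_) (φ-large m)) (lem m)
  where
  lem : ∀ m → 12 + (6 + 6 * m) ≡ 6 * (3 + m)
  lem = solve-∀

c≤12 : ∀ w → c w ≤ 12
c≤12 0 = z≤n
c≤12 1 = m≤m+n 6 6
c≤12 2 = m≤m+n 10 2
c≤12 (suc (suc (suc m))) = ≤-refl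

c≤6* : ∀ w → c w ≤ 6 * w
c≤6* w = ≤-trans (m≤m+n (c w) (φ w)) (≤-reflexive (c+φ w))

s≤6 : ∀ w → s w ≤ 6
s≤6 0 = z≤n
s≤6 1 = m≤m+n 2 4
s≤6 2 = m≤m+n 4 2
s≤6 (suc (suc (suc m))) = ≤-refl

s-mono : ∀ {v w} → v ≤ w → s v ≤ s w
s-mono {0} _ = z≤n
s-mono {1} {suc zero} _ = ≤-refl
s-mono {1} {suc (suc zero)} _ = m≤m+n 2 2
s-mono {1} {suc (suc (suc w))} _ = m≤m+n 2 4
s-mono {2} {suc (suc zero)} _ = ≤-refl
s-mono {2} {suc (suc (suc w))} _ = m≤m+n 4 2
s-mono {suc (suc (suc v))} {suc (suc (suc w))} _ = ≤-refl
s-mono {suc (suc v)} {suc zero} (s≤s ())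
s-mono {suc (suc (suc v))} {suc (suc zero)} (s≤s (s≤s ()))

-- All copies beyond the first are paid for by the penalty. At the end this turns a small `Φ` into
-- many distinct edges.
w≤1+φ : ∀ w → w ≤ 1 + φ w
w≤1+φ 0 = z≤n
w≤1+φ 1 = ≤-refl
w≤1+φ 2 = m≤m+n 2 1
w≤1+φ (suc (suc (suc m))) rewrite φ-large m = ≤-witness (4 + 5 * m) (lem m)
  where
  lem : ∀ m → 1 + (6 + 6 * m) ≡ 3 + m + (4 + 5 * m)
  lem = solve-∀

-- A Young-type splitting of a multiplicity at v times a marginal cost. Summed over a row, the
-- w-part is controlled by the degree and the φ-part by the penalty released at v. Equality occurs
-- at r = 2, w = 3.
r*s≤2w+3φ : ∀ r w → r * s w ≤ 2 * w + 3 * φ r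
r*s≤2w+3φ 0 w = z≤n
r*s≤2w+3φ 1 w = ≤-trans (≤-reflexive (+-identityʳ (s w))) (≤-trans (lem w) (≤-reflexive (sym (+-identityʳ _))))
  where
  lem : ∀ w → s w ≤ 2 * w
  lem 0 = z≤n
  lem 1 = ≤-refl
  lem 2 = ≤-refl
  lem (suc (suc (suc m))) = *-monoʳ-≤ 2 (m≤m+n 3 m)
r*s≤2w+3φ 2 w = lem w
  where
  lem : ∀ w → 2 * s w ≤ 2 * w + 6
  lem 0 = z≤n
  lem 1 = m≤m+n 4 4
  lem 2 = m≤m+n 8 2
  lem (suc (suc (suc m))) = ≤-witness (2 * m) (eq m)
    where
    eq : ∀ m → 2 * (3 + m) + 6 ≡ 12 + 2 * m
    eq = solve-∀
r*s≤2w+3φ (suc (suc (suc m))) w rewrite φ-large m = ≤-trans (*-monoʳ-≤ (3 + m) (s≤6 w)) (≤-witness (2 * w + 12 * m) (eq w m))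
  where
  eq : ∀ w m → 2 * w + 3 * (6 + 6 * m) ≡ (3 + m) * 6 + (2 * w + 12 * m)
  eq = solve-∀

-- The same splitting with more weight on the degree. The coefficient 1 of `φ r` is what allows an
-- exact absorption in `saving-rows`. Tight at w = 3 for every r ≥ 3.
r*s≤4w+φ : ∀ r w → r * s w ≤ 4 * w + φ r
r*s≤4w+φ 0 w = z≤n
r*s≤4w+φ 1 w = ≤-trans (≤-reflexive (+-identityʳ (s w))) (≤-trans (lem w) (≤-reflexive (sym (+-identityʳ _))))
  where
  lem : ∀ w → s w ≤ 4 * w
  lem 0 = z≤n
  lem 1 = m≤m+n 2 2
  lem 2 = m≤m+n 4 4
  lem (suc (suc (suc m))) = ≤-trans (m≤m+n 6 6) (*-monoʳ-≤ 4 (m≤m+n 3 m))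
r*s≤4w+φ 2 w = lem w
  where
  lem : ∀ w → 2 * s w ≤ 4 * w + 2
  lem 0 = z≤n
  lem 1 = m≤m+n 4 2
  lem 2 = m≤m+n 8 2
  lem (suc (suc (suc m))) = ≤-witness (2 + 4 * m) (eq m)
    where
    eq : ∀ m → 4 * (3 + m) + 2 ≡ 12 + (2 + 4 * m)
    eq = solve-∀
r*s≤4w+φ (suc (suc (suc m))) w rewrite φ-large m = lem w
  where
  eq₁ : ∀ m → 4 + (6 + 6 * m) ≡ (3 + m) * 2 + (4 + 4 * m)
  eq₁ = solve-∀
  eq₂ : ∀ m → 8 + (6 + 6 * m) ≡ (3 + m) * 4 + (2 + 2 * m)
  eq₂ = solve-∀
  eq₃ : ∀ m j → 4 * (3 + j) + (6 + 6 * m) ≡ (3 + m) * 6 + 4 * j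
  eq₃ = solve-∀
  lem : ∀ w → (3 + m) * s w ≤ 4 * w + (6 + 6 * m)
  lem 0 = ≤-trans (≤-reflexive (*-zeroʳ (3 + m))) z≤n
  lem 1 = ≤-witness _ (eq₁ m)
  lem 2 = ≤-witness _ (eq₂ m)
  lem (suc (suc (suc j))) = ≤-witness _ (eq₃ m j)

7r≤8+3φ : ∀ r → 7 * r ≤ 8 + 3 * φ r
7r≤8+3φ 0 = z≤n
7r≤8+3φ 1 = m≤m+n 7 1
7r≤8+3φ 2 = ≤-refl
7r≤8+3φ (suc (suc (suc m))) rewrite φ-large m = ≤-witness (5 + 11 * m) (eq m)
  where
  eq : ∀ m → 8 + 3 * (6 + 6 * m) ≡ 7 * (3 + m) + (5 + 11 * m)
  eq = solve-∀

-- Diagonal counterpart of `r*s≤4w+φ`: 6 r is `c r + φ r` with `c` bounded. The leftover r, bounded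
-- later by d, is the source of the summand 6 d in the coefficient of P.
7r≤12+r+φ : ∀ r → 7 * r ≤ 12 + r + φ r
7r≤12+r+φ r = ≤-trans (≤-reflexive (trans (+-comm r (6 * r)) (cong (_+ r) (sym (c+φ r)))))
  (≤-trans (+-monoˡ-≤ r (+-monoˡ-≤ (φ r) (c≤12 r))) (≤-reflexive (eq (φ r) r)))
  where
  eq : ∀ a r → 12 + a + r ≡ 12 + r + a
  eq = solve-∀

-- Multigraphs as lists of ordered pairs, and swap-stable pairings

extract : ∀ {A : Set} {x : A} {xs} → x ∈ xs → ∃ λ ys → xs ↭ x ∷ ys
extract {x = x} m with ∈-∃++ m
... | ys , zs , refl = ys ++ zs , shift x ys zs

module Counting {V : Set} (_≟_ : DecidableEquality V) where

  δ : V → V → ℕ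
  δ x y with x ≟ y
  ... | yes _ = 1
  ... | no  _ = 0

  δ-refl : ∀ x → δ x x ≡ 1
  δ-refl x with x ≟ x
  ... | yes _ = refl
  ... | no ne = ⊥-elim (ne refl)

  δ-≢ : ∀ {x y} → x ≢ y → δ x y ≡ 0
  δ-≢ {x} {y} ne with x ≟ y
  ... | yes eq = ⊥-elim (ne eq)
  ... | no _ = refl

  δ≤1 : ∀ x y → δ x y ≤ 1
  δ≤1 x y with x ≟ y
  ... | yes _ = ≤-refl
  ... | no _ = z≤n

  sift-∉ : ∀ {a} U (h : V → ℕ) → a ∉ U → ∑ U (λ x → δ a x * h x) ≡ 0
  sift-∉ [] h a∉ = refl
  sift-∉ {a} (x ∷ U) h a∉ rewrite δ-≢ {a} {x} (λ eq → a∉ (here eq)) = sift-∉ U h (a∉ ∘ there)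

  sift : ∀ {a U} (h : V → ℕ) → Unique U → a ∈ U → ∑ U (λ x → δ a x * h x) ≡ h a
  sift {a} {x ∷ U} h (x∉ ∷ u) (here refl) rewrite δ-refl a =
    trans (cong₂ _+_ (+-identityʳ (h a)) (sift-∉ U h (λ m → All.lookup x∉ m refl))) (+-identityʳ (h a))
  sift {a} {x ∷ U} h (x∉ ∷ u) (there m) rewrite δ-≢ {a} {x} (λ eq → All.lookup x∉ m (sym eq)) = sift h u m

  cnt : List V → V → ℕ
  cnt xs x = ∑ xs (λ a → δ a x)

  ∑-cnt : ∀ {U} xs (h : V → ℕ) → Unique U → (∀ {a} → a ∈ xs → a ∈ U) →
          ∑ U (λ x → cnt xs x * h x) ≡ ∑ xs h
  ∑-cnt {U} xs h u sub = begin
    ∑ U (λ x → cnt xs x * h x)                ≡⟨ ∑-cong U (λ x → sym (∑-*ʳ xs (λ a → δ a x) (h x))) ⟩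
    ∑ U (λ x → ∑ xs (λ a → δ a x * h x))      ≡⟨ ∑-comm U xs _ ⟩
    ∑ xs (λ a → ∑ U (λ x → δ a x * h x))      ≡⟨ ∑-cong∈ xs (λ a m → sift h u (sub m)) ⟩
    ∑ xs h                                    ∎
    where open ≡-Reasoning

  ∑-cnt≡length : ∀ {U} xs → Unique U → (∀ {a} → a ∈ xs → a ∈ U) → ∑ U (cnt xs) ≡ length xs
  ∑-cnt≡length {U} xs u sub = trans (∑-cong U (λ x → sym (*-identityʳ (cnt xs x))))
    (trans (∑-cnt xs (const 1) u sub) (trans (∑-const xs 1) (*-identityʳ (length xs))))

  src tgt : List (V × V) → List V
  src = map proj₁
  tgt = map proj₂

  w : List (V × V) → V → V → ℕ
  w L x y = ∑ L (λ e → δ (proj₁ e) x * δ (proj₂ e) y)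

  w-↭ : ∀ {L L'} → L ↭ L' → ∀ x y → w L x y ≡ w L' x y
  w-↭ p x y = ∑-↭ _ p

  out inn : List (V × V) → V → ℕ
  out L x = ∑ L (λ e → δ (proj₁ e) x)
  inn L y = ∑ L (λ e → δ (proj₂ e) y)

  Within : List V → List (V × V) → Set
  Within U L = ∀ {a b} → (a , b) ∈ L → a ∈ U × b ∈ U

  ∑-w-row : ∀ {U} L → Unique U → Within U L → ∀ x → ∑ U (w L x) ≡ out L x
  ∑-w-row {U} L u wi x = trans (∑-comm U L _) (∑-cong∈ L λ { (a , b) m → begin
    ∑ U (λ y → δ a x * δ b y)       ≡⟨ ∑-*ˡ U (δ a x) (δ b) ⟩
    δ a x * ∑ U (δ b)               ≡⟨ cong (δ a x *_) (∑-cong U (λ y → sym (*-identityʳ (δ b y)))) ⟩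
    δ a x * ∑ U (λ y → δ b y * 1)   ≡⟨ cong (δ a x *_) (sift (const 1) u (proj₂ (wi m))) ⟩
    δ a x * 1                       ≡⟨ *-identityʳ _ ⟩
    δ a x                           ∎ })
    where open ≡-Reasoning

  ∑-w-col : ∀ {U} L → Unique U → Within U L → ∀ y → ∑ U (λ x → w L x y) ≡ inn L y
  ∑-w-col {U} L u wi y = trans (∑-comm U L _) (∑-cong∈ L λ { (a , b) m → begin
    ∑ U (λ x → δ a x * δ b y)       ≡⟨ sift (λ _ → δ b y) u (proj₁ (wi m)) ⟩
    δ b y                           ∎ })
    where open ≡-Reasoning

  w-≥1 : ∀ {L x y} → (x , y) ∈ L → 1 ≤ w L x y
  w-≥1 {L} {x} {y} m = ≤-trans (≤-reflexive (sym (cong₂ _*_ (δ-refl x) (δ-refl y)))) (term≤∑ _ m)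

  w-≥1⁻ : ∀ L {x y} → 1 ≤ w L x y → (x , y) ∈ L
  w-≥1⁻ ((a , b) ∷ L) {x} {y} le with a ≟ x | b ≟ y
  ... | yes refl | yes refl = here refl
  ... | yes refl | no _     = there (w-≥1⁻ L le)
  ... | no _     | _        = there (w-≥1⁻ L le)

  -- A loop costs 7, slightly more than any off-diagonal edge can; hence two swappable loops never survive
  -- in a swap-minimal pairing.
  ψ : V → V → ℕ → ℕ
  ψ x y k with x ≟ y
  ... | yes _ = 7 * k
  ... | no  _ = φ k

  γ : V → V → ℕ → ℕ
  γ x y k with x ≟ y
  ... | yes _ = 7
  ... | no  _ = s k

  ψ-suc : ∀ x y k → ψ x y (suc k) ≡ γ x y k + ψ x y k
  ψ-suc x y k with x ≟ y
  ... | yes _ = *-suc 7 k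
  ... | no  _ = refl

  ψ-≢ : ∀ {x y} k → x ≢ y → ψ x y k ≡ φ k
  ψ-≢ {x} {y} k ne with x ≟ y
  ... | yes eq = ⊥-elim (ne eq)
  ... | no _   = refl

  ψ-refl : ∀ x k → ψ x x k ≡ 7 * k
  ψ-refl x k with x ≟ x
  ... | yes _ = refl
  ... | no ne = ⊥-elim (ne refl)

  γ-≢ : ∀ {x y} k → x ≢ y → γ x y k ≡ s k
  γ-≢ {x} {y} k ne with x ≟ y
  ... | yes eq = ⊥-elim (ne eq)
  ... | no _   = refl

  γ-refl : ∀ x k → γ x x k ≡ 7
  γ-refl x k with x ≟ x
  ... | yes _ = refl
  ... | no ne = ⊥-elim (ne refl)

  γ-mono : ∀ x y {k l} → k ≤ l → γ x y k ≤ γ x y l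
  γ-mono x y le with x ≟ y
  ... | yes _ = ≤-refl
  ... | no  _ = s-mono le

  γ≤6+δ : ∀ x y k → γ x y k ≤ 6 + δ x y
  γ≤6+δ x y k with x ≟ y
  ... | yes _ = ≤-refl
  ... | no  _ = s≤6 k

  γ≤7 : ∀ x y k → γ x y k ≤ 7
  γ≤7 x y k = ≤-trans (γ≤6+δ x y k) (+-monoʳ-≤ 6 (δ≤1 x y))

  r*γ≤2w+3φ : ∀ x y r k → r * γ x y k ≤ 2 * k + 3 * φ r + δ x y * 8
  r*γ≤2w+3φ x y r k with x ≟ y
  ... | yes _ = ≤-trans (≤-reflexive (*-comm r 7)) (≤-trans (7r≤8+3φ r)
                  (≤-witness (2 * k) (lem k (φ r))))
    where
    lem : ∀ k a → 2 * k + 3 * a + 8 ≡ 8 + 3 * a + 2 * k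
    lem = solve-∀
  ... | no  _ = ≤-trans (r*s≤2w+3φ r k) (m≤m+n _ 0)

  r*γ≤4w+φ : ∀ x y r k → r * γ x y k ≤ 4 * k + φ r + δ x y * (12 + r)
  r*γ≤4w+φ x y r k with x ≟ y
  ... | yes _ = ≤-trans (≤-reflexive (*-comm r 7)) (≤-trans (7r≤12+r+φ r)
                  (≤-witness (4 * k) (lem k (φ r) r)))
    where
    lem : ∀ k a r → 4 * k + a + 1 * (12 + r) ≡ 12 + r + a + 4 * k
    lem = solve-∀
  ... | no  _ = ≤-trans (r*s≤4w+φ r k) (m≤m+n _ 0)

  -- The total penalty and its change under swaps

  Φ : List V → List (V × V) → ℕ
  Φ U L = ∑ U (λ x → ∑ U (λ y → ψ x y (w L x y)))

  Φ-↭ : ∀ {U L L'} → L ↭ L' → Φ U L ≡ Φ U L'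
  Φ-↭ {U} p = ∑-cong U (λ x → ∑-cong U (λ y → cong (ψ x y) (w-↭ p x y)))

  Φ-∷ : ∀ {U a b} L → Unique U → a ∈ U → b ∈ U → Φ U ((a , b) ∷ L) ≡ γ a b (w L a b) + Φ U L
  Φ-∷ {U} {a} {b} L u a∈ b∈ = begin
    Φ U ((a , b) ∷ L)
      ≡⟨ ∑-cong U (λ x → trans (∑-cong U (λ y → point x y)) (∑-+ U _ _)) ⟩
    ∑ U (λ x → ∑ U (λ y → δ a x * (δ b y * γ x y (w L x y))) + ∑ U (λ y → ψ x y (w L x y)))
      ≡⟨ ∑-+ U _ _ ⟩
    ∑ U (λ x → ∑ U (λ y → δ a x * (δ b y * γ x y (w L x y)))) + Φ U L
      ≡⟨ cong (_+ Φ U L) (∑-cong U (λ x → trans (∑-*ˡ U (δ a x) _) (cong (δ a x *_) (sift (λ y → γ x y (w L x y)) u b∈)))) ⟩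
    ∑ U (λ x → δ a x * γ x b (w L x b)) + Φ U L
      ≡⟨ cong (_+ Φ U L) (sift (λ x → γ x b (w L x b)) u a∈) ⟩
    γ a b (w L a b) + Φ U L ∎
    where
    open ≡-Reasoning
    point : ∀ x y → ψ x y (δ a x * δ b y + w L x y) ≡ δ a x * (δ b y * γ x y (w L x y)) + ψ x y (w L x y)
    point x y with a ≟ x | b ≟ y
    ... | yes _ | yes _ = trans (ψ-suc x y (w L x y)) (cong (_+ ψ x y (w L x y)) (sym (trans (+-identityʳ _) (+-identityʳ _))))
    ... | yes _ | no  _ = refl
    ... | no  _ | _     = refl

  -- γ⁻ M L a b is the cost of the last copy of a b in M ++ L, i.e. what removing one copy saves.
  γ⁺ γ⁻ : List (V × V) → List (V × V) → V → V → ℕ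
  γ⁺ M L a b = γ a b (w (M ++ L) a b)
  γ⁻ M L a b = γ a b (pred (w (M ++ L) a b))

  -- All four costs are taken in the same multigraph `M ++ L`, so the right side may overestimate a
  -- real swap. In return its terms depend only on endpoints, and their sum over all pairs of edges
  -- factors through the multiplicities at v.
  Stable : List (V × V) → List (V × V) → Set
  Stable M L = ∀ {a b a' b'} → (a , b) ∈ M → (a' , b') ∈ M →
               γ⁻ M L a b + γ⁻ M L a' b' ≤ γ⁺ M L a b' + γ⁺ M L a' b

  γ⁻≤γ⁺ : ∀ M L a b → γ⁻ M L a b ≤ γ⁺ M L a b
  γ⁻≤γ⁺ M L a b = γ-mono a b pred[n]≤n

  -- The two removals save exactly the two `γ⁻`: since a ≢ a' they concern different pairs and do
  -- not interact. Each insertion costs at most `γ⁺` because marginal costs are monotone.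
  swap-decreases : ∀ {U M R} L {a b a' b'} → Unique U → Within U M → M ↭ (a , b) ∷ (a' , b') ∷ R →
    a ≢ a' → b ≢ b' → γ⁺ M L a b' + γ⁺ M L a' b < γ⁻ M L a b + γ⁻ M L a' b' →
    Φ U (((a , b') ∷ (a' , b) ∷ R) ++ L) < Φ U (M ++ L)
  swap-decreases {U} {M} {R} L {a} {b} {a'} {b'} u wi p a≢a' b≢b' lt = begin-strict
    Φ U (((a , b') ∷ (a' , b) ∷ R) ++ L)
      ≡⟨ trans (Φ-∷ ((a' , b) ∷ B) u a∈ b'∈) (cong (γ a b' (w ((a' , b) ∷ B) a b') +_) (Φ-∷ B u a'∈ b∈)) ⟩
    γ a b' (w ((a' , b) ∷ B) a b') + (γ a' b (w B a' b) + Φ U B)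
      ≤⟨ +-mono-≤ (γ-mono a b' le₁) (+-monoˡ-≤ (Φ U B) (γ-mono a' b le₂)) ⟩
    γ⁺ M L a b' + (γ⁺ M L a' b + Φ U B)
      ≡⟨ sym (+-assoc (γ⁺ M L a b') _ _) ⟩
    γ⁺ M L a b' + γ⁺ M L a' b + Φ U B
      <⟨ +-monoˡ-< (Φ U B) lt ⟩
    γ⁻ M L a b + γ⁻ M L a' b' + Φ U B
      ≡⟨ +-assoc (γ⁻ M L a b) _ _ ⟩
    γ⁻ M L a b + (γ⁻ M L a' b' + Φ U B)
      ≡⟨ cong₂ (λ s t → γ a b s + (γ a' b' t + Φ U B)) e₁ e₂ ⟩
    γ a b (w ((a' , b') ∷ B) a b) + (γ a' b' (w B a' b') + Φ U B)
      ≡⟨ sym (trans (Φ-∷ ((a' , b') ∷ B) u a∈ b∈) (cong (γ a b (w ((a' , b') ∷ B) a b) +_) (Φ-∷ B u a'∈ b'∈))) ⟩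
    Φ U ((a , b) ∷ (a' , b') ∷ B)
      ≡⟨ sym (Φ-↭ {U} q) ⟩
    Φ U (M ++ L) ∎
    where
    open ≤-Reasoning
    B = R ++ L
    q : M ++ L ↭ (a , b) ∷ (a' , b') ∷ B
    q = ++⁺ʳ L p
    a∈ : a ∈ U
    a∈ = proj₁ (wi (∈-resp-↭ (↭-sym p) (here refl)))
    b∈ : b ∈ U
    b∈ = proj₂ (wi (∈-resp-↭ (↭-sym p) (here refl)))
    a'∈ : a' ∈ U
    a'∈ = proj₁ (wi (∈-resp-↭ (↭-sym p) (there (here refl))))
    b'∈ : b' ∈ U
    b'∈ = proj₂ (wi (∈-resp-↭ (↭-sym p) (there (here refl))))
    wB≤ : ∀ x y → w B x y ≤ w (M ++ L) x y
    wB≤ x y = ≤-trans (≤-trans (m≤n+m (w B x y) (δ a' x * δ b' y)) (m≤n+m _ (δ a x * δ b y))) (≤-reflexive (sym (w-↭ q x y)))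
    le₁ : w ((a' , b) ∷ B) a b' ≤ w (M ++ L) a b'
    le₁ rewrite δ-≢ {a'} {a} (a≢a' ∘ sym) = wB≤ a b'
    le₂ : w B a' b ≤ w (M ++ L) a' b
    le₂ = wB≤ a' b
    e₁ : pred (w (M ++ L) a b) ≡ w ((a' , b') ∷ B) a b
    e₁ = trans (cong pred (w-↭ q a b)) (cong (λ t → pred (t + w ((a' , b') ∷ B) a b)) (cong₂ _*_ (δ-refl a) (δ-refl b)))
    e₂ : pred (w (M ++ L) a' b') ≡ w B a' b'
    e₂ rewrite w-↭ q a' b' | δ-≢ a≢a' | δ-refl a' | δ-refl b' = refl

  module _ (L : List (V × V)) {U : List V} (u : Unique U) (Inv : List (V × V) → Set)
           (inv-within : ∀ {M} → Inv M → Within U M)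
           (inv-swap : ∀ {M R a b a' b'} → M ↭ (a , b) ∷ (a' , b') ∷ R → Inv M → Inv ((a , b') ∷ (a' , b) ∷ R)) where

    private
      fine? : ∀ M (e e' : V × V) → Dec (γ⁻ M L (proj₁ e) (proj₂ e) + γ⁻ M L (proj₁ e') (proj₂ e')
                                        ≤ γ⁺ M L (proj₁ e) (proj₂ e') + γ⁺ M L (proj₁ e') (proj₂ e))
      fine? M e e' = _ ≤? _

      stabilise-acc : ∀ M → Inv M → Acc _<_ (Φ U (M ++ L)) → ∃ λ M' → Inv M' × Stable M' L
      stabilise-acc M inv (acc rec) with all? (λ e → all? (fine? M e) M) M
      ... | yes ok = M , inv , λ m m' → All.lookup (All.lookup ok m) m'
      ... | no ¬ok with find (¬All⇒Any¬ (λ e → all? (fine? M e) M) M ¬ok)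
      ... | (a , b) , m , ¬ok' with find (¬All⇒Any¬ (fine? M (a , b)) M ¬ok')
      ... | (a' , b') , m' , bad = stabilise-acc _ (inv-swap p inv)
              (rec (swap-decreases L u (inv-within inv) p a≢a' b≢b' (≰⇒> bad)))
        where
        -- If the two edges share an endpoint, both sides of the stability inequality list the same
        -- pairs, and it holds by `γ⁻≤γ⁺`.
        a≢a' : a ≢ a'
        a≢a' refl = bad (≤-trans (+-mono-≤ (γ⁻≤γ⁺ M L a b) (γ⁻≤γ⁺ M L a b'))
                                 (≤-reflexive (+-comm (γ⁺ M L a b) (γ⁺ M L a b'))))
        b≢b' : b ≢ b'
        b≢b' refl = bad (+-mono-≤ (γ⁻≤γ⁺ M L a b) (γ⁻≤γ⁺ M L a' b))
        R₁ = proj₁ (extract m)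
        p₁ : M ↭ (a , b) ∷ R₁
        p₁ = proj₂ (extract m)
        m'' : (a' , b') ∈ R₁
        m'' with ∈-resp-↭ p₁ m'
        ... | here refl = ⊥-elim (a≢a' refl)
        ... | there t = t
        p : M ↭ (a , b) ∷ (a' , b') ∷ proj₁ (extract m'')
        p = ↭-trans p₁ (prep _ (proj₂ (extract m'')))

    stabilise : ∀ M → Inv M → ∃ λ M' → Inv M' × Stable M' L
    stabilise M inv = stabilise-acc M inv (<-wellFounded _)

  saving : List (V × V) → List (V × V) → ℕ
  saving M L = ∑ M (λ e → γ⁻ M L (proj₁ e) (proj₂ e))

  -- Insert the edges of `M` one by one; by convexity each costs at most what the last copy of its
  -- pair costs in the final multigraph.
  Φ-++≤ : ∀ {U} M L → Unique U → Within U M → Φ U (M ++ L) ≤ Φ U L + saving M L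
  Φ-++≤ [] L u wi = ≤-reflexive (sym (+-identityʳ _))
  Φ-++≤ {U} ((a , b) ∷ M) L u wi = begin
    Φ U ((a , b) ∷ M ++ L)            ≡⟨ Φ-∷ (M ++ L) u (proj₁ (wi (here refl))) (proj₂ (wi (here refl))) ⟩
    γ a b (w (M ++ L) a b) + Φ U (M ++ L)
                                      ≤⟨ +-mono-≤ (≤-reflexive (cong (γ a b) (sym e₁))) (Φ-++≤ M L u (wi ∘ there)) ⟩
    g + (Φ U L + saving M L)          ≡⟨ lem g (Φ U L) (saving M L) ⟩
    Φ U L + (g + saving M L)          ≤⟨ +-monoʳ-≤ (Φ U L) (+-monoʳ-≤ g (∑-mono M λ { (x , y) →
                                           γ-mono x y (pred-mono-≤ (m≤n+m (w (M ++ L) x y) (δ a x * δ b y))) })) ⟩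
    Φ U L + saving ((a , b) ∷ M) L    ∎
    where
    open ≤-Reasoning
    g = γ⁻ ((a , b) ∷ M) L a b
    e₁ : pred (w ((a , b) ∷ M ++ L) a b) ≡ w (M ++ L) a b
    e₁ rewrite δ-refl a | δ-refl b = refl
    lem : ∀ x y z → x + (y + z) ≡ y + (x + z)
    lem = solve-∀

  -- This is d times the expected cost of a uniformly random pairing of the d in-edges with the d
  -- out-edges, every new edge being priced at `γ⁺`.
  swap-sum : List (V × V) → List (V × V) → ℕ
  swap-sum M L = ∑ M (λ e → ∑ M (λ e' → γ⁺ M L (proj₁ e) (proj₂ e')))

  -- Sum stability over all ordered pairs of edges of `M`. The left side gives the saving d times
  -- from each slot; on the right the two terms are transposes of each other. Both sides are thus
  -- doubled.
  d*saving≤swap-sum : ∀ M L → Stable M L → length M * saving M L ≤ swap-sum M L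
  d*saving≤swap-sum M L st = *-cancelˡ-≤ 2 (begin
    2 * (length M * saving M L)
      ≡⟨ lem (length M * saving M L) ⟩
    length M * saving M L + length M * saving M L
      ≡⟨ cong₂ _+_ (sym (trans (∑-cong M (λ e → ∑-const M _)) (∑-*ˡ M (length M) _))) (sym (∑-const M (saving M L))) ⟩
    ∑ M (λ e → ∑ M (λ e' → h e)) + ∑ M (λ e → ∑ M h)
      ≡⟨ sym (trans (∑-cong M (λ e → ∑-+ M (λ _ → h e) h)) (∑-+ M _ _)) ⟩
    ∑ M (λ e → ∑ M (λ e' → h e + h e'))
      ≤⟨ ∑-mono∈ M (λ e m → ∑-mono∈ M (λ e' m' → st m m')) ⟩
    ∑ M (λ e → ∑ M (λ e' → t e e' + t e' e))
      ≡⟨ trans (∑-cong M (λ e → ∑-+ M (t e) (λ e' → t e' e))) (∑-+ M _ _) ⟩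
    swap-sum M L + ∑ M (λ e → ∑ M (λ e' → t e' e))
      ≡⟨ cong (swap-sum M L +_) (∑-comm M M (λ e e' → t e' e)) ⟩
    swap-sum M L + swap-sum M L
      ≡⟨ sym (lem (swap-sum M L)) ⟩
    2 * swap-sum M L ∎)
    where
    open ≤-Reasoning
    h : V × V → ℕ
    h e = γ⁻ M L (proj₁ e) (proj₂ e)
    t : V × V → V × V → ℕ
    t e e' = γ⁺ M L (proj₁ e) (proj₂ e')
    lem : ∀ x → 2 * x ≡ x + x
    lem = solve-∀

-- The cost of a stable pairing

pos : ℕ → ℕ
pos zero    = 0
pos (suc _) = 1

pos≤ : ∀ k → pos k ≤ k
pos≤ zero    = z≤n
pos≤ (suc k) = s≤s z≤n

c≤12pos : ∀ k → c k ≤ 12 * pos k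
c≤12pos zero    = z≤n
c≤12pos (suc k) = c≤12 (suc k)

s≤6pos : ∀ k → s k ≤ 6 * pos k
s≤6pos zero    = z≤n
s≤6pos (suc k) = s≤6 (suc k)

∑-∑-* : ∀ {A B : Set} (xs : List A) (ys : List B) (f : A → ℕ) (g : B → ℕ) →
        ∑ xs (λ x → ∑ ys (λ y → f x * g y)) ≡ ∑ xs f * ∑ ys g
∑-∑-* xs ys f g = trans (∑-cong xs (λ x → ∑-*ˡ ys (f x) g)) (∑-*ʳ xs f (∑ ys g))

∑∑-+ : ∀ {A : Set} (xs ys : List A) (f g : A → A → ℕ) →
       ∑ xs (λ x → ∑ ys (λ y → f x y + g x y)) ≡ ∑ xs (λ x → ∑ ys (f x)) + ∑ xs (λ x → ∑ ys (g x))
∑∑-+ xs ys f g = trans (∑-cong xs (λ x → ∑-+ ys (f x) (g x))) (∑-+ xs (λ x → ∑ ys (f x)) (λ x → ∑ ys (g x)))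

∑∑-*ˡ : ∀ {A : Set} (xs ys : List A) k (f : A → A → ℕ) →
        ∑ xs (λ x → ∑ ys (λ y → k * f x y)) ≡ k * ∑ xs (λ x → ∑ ys (f x))
∑∑-*ˡ xs ys k f = trans (∑-cong xs (λ x → ∑-*ˡ ys k (f x))) (∑-*ˡ xs k (λ x → ∑ ys (f x)))

module Bilinear {V : Set} (_≟_ : DecidableEquality V) where
  open Counting _≟_

  δ-sym : ∀ x y → δ x y ≡ δ y x
  δ-sym x y with x ≟ y | y ≟ x
  ... | yes _  | yes _  = refl
  ... | no _   | no _   = refl
  ... | yes eq | no ne  = ⊥-elim (ne (sym eq))
  ... | no ne  | yes eq = ⊥-elim (ne (sym eq))

  -- The adjacency matrix of the loopless simple digraph underlying `L`.
  arc : List (V × V) → V → V → ℕ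
  arc L x y with x ≟ y
  ... | yes _ = 0
  ... | no  _ = pos (w L x y)

  -- Here 864 = 12 · 12 · 6 and 1008 = 12 · 12 · 7. Off the diagonal the cost vanishes unless x y is
  -- already an edge, so the bounded parts are controlled by a count of distinct edges.
  c*c*γ : ∀ L p r x y → c p * (c r * γ x y (w L x y)) ≤ 864 * (pos p * (pos r * arc L x y)) + 1008 * (δ x y * pos p)
  c*c*γ L p r x y with x ≟ y
  ... | yes _ = ≤-trans (diagonal (c p) (c r) (pos p) (c≤12pos p) (c≤12 r)) (m≤n+m (1008 * (1 * pos p)) (864 * (pos p * (pos r * 0))))
    where
    diagonal : ∀ a b t → a ≤ 12 * t → b ≤ 12 → a * (b * 7) ≤ 1008 * (1 * t)
    diagonal a b t ha hb = ≤-trans (*-mono-≤ ha (*-monoˡ-≤ 7 hb)) (≤-reflexive (lem t))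
      where
      lem : ∀ t → 12 * t * 84 ≡ 1008 * (1 * t)
      lem = solve-∀
  ... | no _ = ≤-trans (light (c p) (c r) (s (w L x y)) (pos p) (pos r) (pos (w L x y)) (c≤12pos p) (c≤12pos r) (s≤6pos (w L x y)))
                       (m≤m+n (864 * (pos p * (pos r * pos (w L x y)))) (1008 * 0))
    where
    light : ∀ a b e t t' t'' → a ≤ 12 * t → b ≤ 12 * t' → e ≤ 6 * t'' → a * (b * e) ≤ 864 * (t * (t' * t''))
    light a b e t t' t'' ha hb he = ≤-trans (*-mono-≤ ha (*-mono-≤ hb he)) (≤-reflexive (lem t t' t''))
      where
      lem : ∀ a b t → 12 * a * (12 * b * (6 * t)) ≡ 864 * (a * (b * t))
      lem = solve-∀

  ∑c+∑φ : ∀ U (p : V → ℕ) → ∑ U (c ∘ p) + ∑ U (φ ∘ p) ≡ 6 * ∑ U p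
  ∑c+∑φ U p = trans (sym (∑-+ U _ _)) (trans (∑-cong U (λ x → c+φ (p x))) (∑-*ˡ U 6 p))

  form : List V → (V → ℕ) → (V → ℕ) → (V → V → ℕ) → ℕ
  form U p r g = ∑ U (λ x → ∑ U (λ y → p x * (r y * g x y)))

  -- 36 p r = (c p + φ p) (c r + φ r), regrouped as c p · c r + φ p · 6 r + c p · φ r.
  form-split : ∀ U p r g → 36 * form U p r g ≡
    form U (c ∘ p) (c ∘ r) g + 6 * ∑ U (λ x → φ (p x) * ∑ U (λ y → r y * g x y)) + form U (c ∘ p) (φ ∘ r) g
  form-split U p r g = begin
    36 * form U p r g
      ≡⟨ sym (∑∑-*ˡ U U 36 (λ x y → p x * (r y * g x y))) ⟩
    ∑ U (λ x → ∑ U (λ y → 36 * (p x * (r y * g x y))))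
      ≡⟨ ∑-cong U (λ x → ∑-cong U (λ y → point x y)) ⟩
    ∑ U (λ x → ∑ U (λ y → cc x y + m x y + cφ x y))
      ≡⟨ ∑∑-+ U U (λ x y → cc x y + m x y) cφ ⟩
    ∑ U (λ x → ∑ U (λ y → cc x y + m x y)) + form U (c ∘ p) (φ ∘ r) g
      ≡⟨ cong (_+ form U (c ∘ p) (φ ∘ r) g) (∑∑-+ U U cc m) ⟩
    form U (c ∘ p) (c ∘ r) g + ∑ U (λ x → ∑ U (m x)) + form U (c ∘ p) (φ ∘ r) g
      ≡⟨ cong (λ t → form U (c ∘ p) (c ∘ r) g + t + form U (c ∘ p) (φ ∘ r) g)
           (trans (∑∑-*ˡ U U 6 (λ x y → φ (p x) * (r y * g x y)))
             (cong (6 *_) (∑-cong U (λ x → ∑-*ˡ U (φ (p x)) (λ y → r y * g x y))))) ⟩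
    form U (c ∘ p) (c ∘ r) g + 6 * ∑ U (λ x → φ (p x) * ∑ U (λ y → r y * g x y)) + form U (c ∘ p) (φ ∘ r) g ∎
    where
    open ≡-Reasoning
    cc m cφ : V → V → ℕ
    cc x y = c (p x) * (c (r y) * g x y)
    m x y = 6 * (φ (p x) * (r y * g x y))
    cφ x y = c (p x) * (φ (r y) * g x y)
    expand : ∀ a f a' f' t → (a + f) * ((a' + f') * t) ≡ a * (a' * t) + f * ((a' + f') * t) + a * (f' * t)
    expand = solve-∀
    assemble : ∀ a b t → 36 * (a * (b * t)) ≡ 6 * a * (6 * b * t)
    assemble = solve-∀
    middle : ∀ f b t → f * (6 * b * t) ≡ 6 * (f * (b * t))
    middle = solve-∀
    point : ∀ x y → 36 * (p x * (r y * g x y)) ≡ cc x y + m x y + cφ x y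
    point x y = begin
      36 * (p x * (r y * g x y))
        ≡⟨ assemble (p x) (r y) (g x y) ⟩
      6 * p x * (6 * r y * g x y)
        ≡⟨ sym (cong₂ (λ a b → a * (b * g x y)) (c+φ (p x)) (c+φ (r y))) ⟩
      (c (p x) + φ (p x)) * ((c (r y) + φ (r y)) * g x y)
        ≡⟨ expand (c (p x)) (φ (p x)) (c (r y)) (φ (r y)) (g x y) ⟩
      cc x y + φ (p x) * ((c (r y) + φ (r y)) * g x y) + cφ x y
        ≡⟨ cong (λ t → cc x y + t + cφ x y) (trans (cong (λ b → φ (p x) * (b * g x y)) (c+φ (r y))) (middle (φ (p x)) (r y) (g x y))) ⟩
      cc x y + m x y + cφ x y ∎

  rows-≤ : ∀ (U : List V) (p r : V → ℕ) (g : V → V → ℕ) ρ → (∀ {x} → x ∈ U → ∑ U (λ y → r y * g x y) ≤ ρ) →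
           ∑ U (λ x → φ (p x) * ∑ U (λ y → r y * g x y)) ≤ ∑ U (φ ∘ p) * ρ
  rows-≤ U p r g ρ h = ≤-trans (∑-mono∈ U (λ x m → *-monoʳ-≤ (φ (p x)) (h m))) (≤-reflexive (∑-*ʳ U (φ ∘ p) ρ))

  -- The asymmetric estimate: only the part weighted by `φ ∘ p` uses the row bound ρ, the other uses
  -- g ≤ 6 + δ. The factor `∑ U (c ∘ p)` is not replaced by 6 d yet, because its deficit is exactly
  -- `∑ U (φ ∘ p)`.
  form-bound₁ : ∀ {U} p r (g : V → V → ℕ) E ρ → Unique U → (∀ x y → g x y ≤ 6 + δ x y) →
    form U (c ∘ p) (c ∘ r) g ≤ E →
    (∀ {x} → x ∈ U → ∑ U (λ y → r y * g x y) ≤ ρ) →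
    36 * form U p r g ≤ E + 6 * (∑ U (φ ∘ p) * ρ) + (6 * (∑ U (c ∘ p) * ∑ U (φ ∘ r)) + 12 * ∑ U (φ ∘ r))
  form-bound₁ {U} p r g E ρ u g≤ light rows = ≤-trans (≤-reflexive (form-split U p r g))
    (+-mono-≤ (+-mono-≤ light (*-monoʳ-≤ 6 (rows-≤ U p r g ρ rows))) (begin
      form U (c ∘ p) (φ ∘ r) g
        ≤⟨ ∑-mono U (λ x → ∑-mono U (λ y → *-monoʳ-≤ (c (p x)) (*-monoʳ-≤ (φ (r y)) (g≤ x y)))) ⟩
      ∑ U (λ x → ∑ U (λ y → c (p x) * (φ (r y) * (6 + δ x y))))
        ≡⟨ ∑-cong U (λ x → ∑-cong U (λ y → lem (c (p x)) (φ (r y)) (δ x y))) ⟩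
      ∑ U (λ x → ∑ U (λ y → 6 * (c (p x) * φ (r y)) + δ x y * (c (p x) * φ (r y))))
        ≡⟨ ∑∑-+ U U (λ x y → 6 * (c (p x) * φ (r y))) (λ x y → δ x y * (c (p x) * φ (r y))) ⟩
      ∑ U (λ x → ∑ U (λ y → 6 * (c (p x) * φ (r y)))) + ∑ U (λ x → ∑ U (λ y → δ x y * (c (p x) * φ (r y))))
        ≡⟨ cong₂ _+_
             (trans (∑∑-*ˡ U U 6 (λ x y → c (p x) * φ (r y))) (cong (6 *_) (∑-∑-* U U (c ∘ p) (φ ∘ r))))
             (∑-cong∈ U (λ x m → sift (λ y → c (p x) * φ (r y)) u m)) ⟩
      6 * (∑ U (c ∘ p) * ∑ U (φ ∘ r)) + ∑ U (λ x → c (p x) * φ (r x))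
        ≤⟨ +-monoʳ-≤ (6 * (∑ U (c ∘ p) * ∑ U (φ ∘ r))) (≤-trans (∑-mono U (λ x → *-monoˡ-≤ (φ (r x)) (c≤12 (p x)))) (≤-reflexive (∑-*ˡ U 12 (φ ∘ r)))) ⟩
      6 * (∑ U (c ∘ p) * ∑ U (φ ∘ r)) + 12 * ∑ U (φ ∘ r) ∎))
    where
    open ≤-Reasoning
    lem : ∀ a b t → a * (b * (6 + t)) ≡ 6 * (a * b) + t * (a * b)
    lem = solve-∀

  form-transpose : ∀ U p r g → form U p r g ≡ form U r p (λ y x → g x y)
  form-transpose U p r g = trans (∑-comm U U (λ x y → p x * (r y * g x y))) (∑-cong U (λ y → ∑-cong U (λ x → lem (p x) (r y) (g x y))))
    where
    lem : ∀ a b t → a * (b * t) ≡ b * (a * t)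
    lem = solve-∀

  -- The symmetric estimate: both penalty-weighted parts profit from a degree bound, which pays off
  -- when both penalties are small.
  form-bound₂ : ∀ {U} p r (g : V → V → ℕ) E ρ ρ' →
    form U (c ∘ p) (c ∘ r) g ≤ E →
    (∀ {x} → x ∈ U → ∑ U (λ y → r y * g x y) ≤ ρ) →
    (∀ {y} → y ∈ U → ∑ U (λ x → p x * g x y) ≤ ρ') →
    36 * form U p r g ≤ E + 6 * (∑ U (φ ∘ p) * ρ) + 6 * (∑ U (φ ∘ r) * ρ')
  form-bound₂ {U} p r g E ρ ρ' light rows cols = ≤-trans (≤-reflexive (form-split U p r g))
    (+-mono-≤ (+-mono-≤ light (*-monoʳ-≤ 6 (rows-≤ U p r g ρ rows))) (begin
      form U (c ∘ p) (φ ∘ r) g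
        ≤⟨ ∑-mono U (λ x → ∑-mono U (λ y → *-monoˡ-≤ (φ (r y) * g x y) (c≤6* (p x)))) ⟩
      ∑ U (λ x → ∑ U (λ y → 6 * p x * (φ (r y) * g x y)))
        ≡⟨ ∑-comm U U (λ x y → 6 * p x * (φ (r y) * g x y)) ⟩
      ∑ U (λ y → ∑ U (λ x → 6 * p x * (φ (r y) * g x y)))
        ≡⟨ ∑-cong U (λ y → ∑-cong U (λ x → lem (p x) (φ (r y)) (g x y))) ⟩
      ∑ U (λ y → ∑ U (λ x → 6 * (φ (r y) * (p x * g x y))))
        ≡⟨ ∑∑-*ˡ U U 6 (λ y x → φ (r y) * (p x * g x y)) ⟩
      6 * ∑ U (λ y → ∑ U (λ x → φ (r y) * (p x * g x y)))
        ≡⟨ cong (6 *_) (∑-cong U (λ y → ∑-*ˡ U (φ (r y)) (λ x → p x * g x y))) ⟩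
      6 * ∑ U (λ y → φ (r y) * ∑ U (λ x → p x * g x y))
        ≤⟨ *-monoʳ-≤ 6 (rows-≤ U r p (λ y x → g x y) ρ' cols) ⟩
      6 * (∑ U (φ ∘ r) * ρ') ∎))
    where
    open ≤-Reasoning
    lem : ∀ a b t → 6 * a * (b * t) ≡ 6 * (b * (a * t))
    lem = solve-∀

  module Pairing {U : List V} (u : Unique U) (M L : List (V × V)) (wi : Within U (M ++ L)) (D : ℕ)
                 (out≡D : ∀ {x} → x ∈ U → out (M ++ L) x ≡ D) (inn≡D : ∀ {x} → x ∈ U → inn (M ++ L) x ≡ D)
                 (src⊆ : ∀ {x} → x ∈ src M → x ∈ U) (tgt⊆ : ∀ {x} → x ∈ tgt M → x ∈ U) where

    W : V → V → ℕ
    W = w (M ++ L)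

    g : V → V → ℕ
    g x y = γ x y (W x y)

    p r : V → ℕ
    p = cnt (src M)
    r = cnt (tgt M)

    d P Q : ℕ
    d = length M
    P = ∑ U (φ ∘ p)
    Q = ∑ U (φ ∘ r)

    ∑p≡d : ∑ U p ≡ d
    ∑p≡d = trans (∑-cnt≡length (src M) u src⊆) (length-map proj₁ M)

    ∑r≡d : ∑ U r ≡ d
    ∑r≡d = trans (∑-cnt≡length (tgt M) u tgt⊆) (length-map proj₂ M)

    ∑-tgt : ∀ (h : V → ℕ) → ∑ M (h ∘ proj₂) ≡ ∑ U (λ y → r y * h y)
    ∑-tgt h = trans (sym (∑-map proj₂ M h)) (sym (∑-cnt (tgt M) h u tgt⊆))

    ∑-src : ∀ (h : V → ℕ) → ∑ M (h ∘ proj₁) ≡ ∑ U (λ x → p x * h x)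
    ∑-src h = trans (sym (∑-map proj₁ M h)) (sym (∑-cnt (src M) h u src⊆))

    swap-sum≡form : swap-sum M L ≡ form U p r g
    swap-sum≡form = trans (∑-src (λ x → ∑ M (g x ∘ proj₂))) (∑-cong U (λ x →
      trans (cong (p x *_) (∑-tgt (g x))) (sym (∑-*ˡ U (p x) _))))

    r≤d : ∀ {x} → x ∈ U → r x ≤ d
    r≤d m = ≤-trans (term≤∑ r m) (≤-reflexive ∑r≡d)

    p≤d : ∀ {x} → x ∈ U → p x ≤ d
    p≤d m = ≤-trans (term≤∑ p m) (≤-reflexive ∑p≡d)

    -- The multiplicities in row x add up to D, and of the diagonal corrections only the one at y =
    -- x survives, so a wasteful treatment of loops is harmless.
    row-linear : ∀ a b (h : V → ℕ) {x} → x ∈ U → (∀ y → r y * g x y ≤ a * W x y + b * φ (r y) + δ x y * h y) →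
                 ∑ U (λ y → r y * g x y) ≤ a * D + b * Q + h x
    row-linear a b h {x} m le = ≤-trans (∑-mono U le) (≤-reflexive
      (trans (∑-+ U _ _) (cong₂ _+_ (trans (∑-+ U _ _) (cong₂ _+_
        (trans (∑-*ˡ U a (W x)) (cong (a *_) (trans (∑-w-row (M ++ L) u wi x) (out≡D m))))
        (∑-*ˡ U b _))) (sift h u m))))

    col-linear : ∀ a b (h : V → ℕ) {y} → y ∈ U → (∀ x → p x * g x y ≤ a * W x y + b * φ (p x) + δ x y * h x) →
                 ∑ U (λ x → p x * g x y) ≤ a * D + b * P + h y
    col-linear a b h {y} m le = ≤-trans (∑-mono U le) (≤-reflexive
      (trans (∑-+ U _ _) (cong₂ _+_ (trans (∑-+ U _ _) (cong₂ _+_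
        (trans (∑-*ˡ U a (λ x → W x y)) (cong (a *_) (trans (∑-w-col (M ++ L) u wi y) (inn≡D m))))
        (∑-*ˡ U b _))) (trans (∑-cong U (λ x → cong (_* h x) (δ-sym x y))) (sift h u m)))))

    row₂₃ : ∀ {x} → x ∈ U → ∑ U (λ y → r y * g x y) ≤ 2 * D + 3 * Q + 8
    row₂₃ {x} m = row-linear 2 3 (const 8) m (λ y → r*γ≤2w+3φ x y (r y) (W x y))

    col₂₃ : ∀ {y} → y ∈ U → ∑ U (λ x → p x * g x y) ≤ 2 * D + 3 * P + 8
    col₂₃ {y} m = col-linear 2 3 (const 8) m (λ x → r*γ≤2w+3φ x y (p x) (W x y))

    row₄₁ : ∀ {x} → x ∈ U → ∑ U (λ y → r y * g x y) ≤ 4 * D + Q + (12 + d)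
    row₄₁ {x} m = ≤-trans (row-linear 4 1 (λ y → 12 + r y) m (λ y → ≤-trans (r*γ≤4w+φ x y (r y) (W x y))
                    (≤-reflexive (cong (λ t → 4 * W x y + t + δ x y * (12 + r y)) (sym (+-identityʳ (φ (r y))))))))
                    (+-mono-≤ (≤-reflexive (cong (4 * D +_) (+-identityʳ Q))) (+-monoʳ-≤ 12 (r≤d m)))

    col₄₁ : ∀ {y} → y ∈ U → ∑ U (λ x → p x * g x y) ≤ 4 * D + P + (12 + d)
    col₄₁ {y} m = ≤-trans (col-linear 4 1 (λ x → 12 + p x) m (λ x → ≤-trans (r*γ≤4w+φ x y (p x) (W x y))
                    (≤-reflexive (cong (λ t → 4 * W x y + t + δ x y * (12 + p x)) (sym (+-identityʳ (φ (p x))))))))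
                    (+-mono-≤ (≤-reflexive (cong (4 * D +_) (+-identityʳ P))) (+-monoʳ-≤ 12 (p≤d m)))

    -- This bound involves no D. It is the better one when loops have used up much of the degree of
    -- v, so that d is far below D.
    row₇ : ∀ {x} → x ∈ U → ∑ U (λ y → r y * g x y) ≤ 7 * d
    row₇ {x} m = ≤-trans (∑-mono U (λ y → *-monoʳ-≤ (r y) (γ≤7 x y (W x y))))
                   (≤-reflexive (trans (∑-*ʳ U r 7) (trans (*-comm (∑ U r) 7) (cong (7 *_) ∑r≡d))))

    -- The number of distinct non-loop edges from in-neighbours to out-neighbours of v, counted
    -- after the pairing. If 2 q reaches k k, these edges already form the required digraph.
    q : ℕ
    q = ∑ U (λ x → ∑ U (λ y → pos (p x) * (pos (r y) * arc (M ++ L) x y)))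

    ε₀ : ℕ
    ε₀ = 864 * q + 1008 * d

    light : form U (c ∘ p) (c ∘ r) g ≤ ε₀
    light = begin
      form U (c ∘ p) (c ∘ r) g
        ≤⟨ ∑-mono U (λ x → ∑-mono U (λ y → c*c*γ (M ++ L) (p x) (r y) x y)) ⟩
      ∑ U (λ x → ∑ U (λ y → 864 * (pos (p x) * (pos (r y) * arc (M ++ L) x y)) + 1008 * (δ x y * pos (p x))))
        ≡⟨ ∑∑-+ U U (λ x y → 864 * (pos (p x) * (pos (r y) * arc (M ++ L) x y))) (λ x y → 1008 * (δ x y * pos (p x))) ⟩
      ∑ U (λ x → ∑ U (λ y → 864 * (pos (p x) * (pos (r y) * arc (M ++ L) x y)))) + ∑ U (λ x → ∑ U (λ y → 1008 * (δ x y * pos (p x))))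
        ≡⟨ cong₂ _+_ (∑∑-*ˡ U U 864 (λ x y → pos (p x) * (pos (r y) * arc (M ++ L) x y)))
             (trans (∑∑-*ˡ U U 1008 (λ x y → δ x y * pos (p x))) (cong (1008 *_) (∑-cong∈ U (λ x m → sift (λ _ → pos (p x)) u m)))) ⟩
      864 * q + 1008 * ∑ U (pos ∘ p)
        ≤⟨ +-monoʳ-≤ (864 * q) (*-monoʳ-≤ 1008 (≤-trans (∑-mono U (λ x → pos≤ (p x))) (≤-reflexive ∑p≡d))) ⟩
      ε₀ ∎
      where open ≤-Reasoning

    private
      cP : ∑ U (c ∘ p) + P ≡ 6 * d
      cP = trans (∑c+∑φ U p) (cong (6 *_) ∑p≡d)
      cQ : ∑ U (c ∘ r) + Q ≡ 6 * d
      cQ = trans (∑c+∑φ U r) (cong (6 *_) ∑r≡d)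

    P≤6d : P ≤ 6 * d
    P≤6d = ≤-trans (m≤n+m P _) (≤-reflexive cP)

    Q≤6d : Q ≤ 6 * d
    Q≤6d = ≤-trans (m≤n+m Q _) (≤-reflexive cQ)

    module _ (st : Stable M L) where

      private
        start : 36 * (d * saving M L) ≤ 36 * form U p r g
        start = *-monoʳ-≤ 36 (≤-trans (d*saving≤swap-sum M L st) (≤-reflexive swap-sum≡form))

        -- The product a b from the row bound joins C b, and C + a = 6 d. Hence b gets essentially
        -- the break-even coefficient 36 d, while that of a is smaller for d close to D.
        finish : ∀ a b C D d → C + a ≡ 6 * d →
          6 * (a * (4 * D + b + (12 + d))) + (6 * (C * b) + 12 * b) ≡ a * (24 * D + 72 + 6 * d) + b * (36 * d + 12)
        finish a b C D d eq = trans (lem a b C D d) (trans (cong (λ t → a * (24 * D + 72 + 6 * d) + b * (6 * t + 12)) eq) (lem' a b D d))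
          where
          lem : ∀ a b C D d → 6 * (a * (4 * D + b + (12 + d))) + (6 * (C * b) + 12 * b) ≡ a * (24 * D + 72 + 6 * d) + b * (6 * (C + a) + 12)
          lem = solve-∀
          lem' : ∀ a b D d → a * (24 * D + 72 + 6 * d) + b * (6 * (6 * d) + 12) ≡ a * (24 * D + 72 + 6 * d) + b * (36 * d + 12)
          lem' = solve-∀

      saving-rows : 36 * (d * saving M L) ≤ ε₀ + (P * (24 * D + 72 + 6 * d) + Q * (36 * d + 12))
      saving-rows = ≤-trans start (≤-trans
        (form-bound₁ p r g ε₀ (4 * D + Q + (12 + d)) u (λ x y → γ≤6+δ x y (W x y)) light row₄₁)
        (≤-reflexive (trans (+-assoc ε₀ _ _) (cong (ε₀ +_) (finish P Q _ D d cP)))))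

      saving-cols : 36 * (d * saving M L) ≤ ε₀ + (Q * (24 * D + 72 + 6 * d) + P * (36 * d + 12))
      saving-cols = ≤-trans start (≤-trans (≤-reflexive (cong (36 *_) (form-transpose U p r g))) (≤-trans
        (form-bound₁ r p (λ y x → g x y) ε₀ (4 * D + P + (12 + d)) u
          (λ y x → ≤-trans (γ≤6+δ x y (W x y)) (≤-reflexive (cong (6 +_) (δ-sym x y))))
          (≤-trans (≤-reflexive (form-transpose U (c ∘ r) (c ∘ p) (λ y x → g x y))) light) col₄₁)
        (≤-reflexive (trans (+-assoc ε₀ _ _) (cong (ε₀ +_) (finish Q P _ D d cQ))))))

      saving-crude : 36 * (d * saving M L) ≤ ε₀ + (P * (42 * d) + Q * (36 * d + 12))
      saving-crude = ≤-trans start (≤-trans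
        (form-bound₁ p r g ε₀ (7 * d) u (λ x y → γ≤6+δ x y (W x y)) light row₇)
        (≤-trans (≤-reflexive (+-assoc ε₀ _ _)) (+-monoʳ-≤ ε₀ (≤-trans
           (+-monoʳ-≤ (6 * (P * (7 * d))) (+-monoˡ-≤ (12 * Q) (*-monoʳ-≤ 6 (*-monoˡ-≤ Q
             (≤-trans (m≤m+n _ P) (≤-reflexive cP))))))
           (≤-reflexive (lem P Q d))))))
        where
        lem : ∀ a b d → 6 * (a * (7 * d)) + (6 * (6 * d * b) + 12 * b) ≡ a * (42 * d) + b * (36 * d + 12)
        lem = solve-∀

      saving-both : 36 * (d * saving M L) ≤ ε₀ + 6 * (P * (2 * D + 3 * Q + 8)) + 6 * (Q * (2 * D + 3 * P + 8))
      saving-both = ≤-trans start (form-bound₂ p r g ε₀ _ _ light row₂₃ col₂₃)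

      -- Compare the loop with every edge a b of `M`: stability gives 7 ≤ g x b + g a x. Summing
      -- produces the row and the column of x. The bounds `row₂₃` and `col₂₃` are chosen because
      -- their degree part 4 D stays below 7 d when d is close to D, which forces P + Q to be large.
      loop⇒heavy : ∀ {x} → (x , x) ∈ M → 7 * d ≤ 4 * D + 3 * (P + Q) + 16
      loop⇒heavy {x} m = begin
        7 * d                                   ≡⟨ trans (*-comm 7 d) (sym (∑-const M 7)) ⟩
        ∑ M (λ _ → 7)                           ≤⟨ ∑-mono∈ M (λ { (a , b) m' → ≤-trans (m≤m+n 7 _)
                                                     (≤-trans (≤-reflexive (cong (_+ γ⁻ M L a b) (sym (γ-refl x _)))) (st m m')) }) ⟩
        ∑ M (λ e → g x (proj₂ e) + g (proj₁ e) x)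
                                                ≡⟨ trans (∑-+ M _ _) (cong₂ _+_ (∑-tgt (g x)) (∑-src (λ z → g z x))) ⟩
        ∑ U (λ y → r y * g x y) + ∑ U (λ z → p z * g z x)
                                                ≤⟨ +-mono-≤ (row₂₃ x∈) (col₂₃ x∈) ⟩
        2 * D + 3 * Q + 8 + (2 * D + 3 * P + 8) ≡⟨ lem D P Q ⟩
        4 * D + 3 * (P + Q) + 16                ∎
        where
        open ≤-Reasoning
        x∈ : x ∈ U
        x∈ = src⊆ (∈-map⁺ proj₁ m)
        lem : ∀ D P Q → 2 * D + 3 * Q + 8 + (2 * D + 3 * P + 8) ≡ 4 * D + 3 * (P + Q) + 16
        lem = solve-∀

      -- Swapping two loops at different vertices gives two non-loops, of cost at most 12 < 14.
      loops-unique : ∀ {x z} → (x , x) ∈ M → (z , z) ∈ M → x ≡ z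
      loops-unique {x} {z} m m' with x ≟ z
      ... | yes eq = eq
      ... | no ne = ⊥-elim (<⇒≱ (s≤s (m≤m+n 12 1)) (begin
        14 ≡⟨ sym (cong₂ _+_ (γ-refl x _) (γ-refl z _)) ⟩
        γ⁻ M L x x + γ⁻ M L z z ≤⟨ st m m' ⟩
        g x z + g z x ≡⟨ cong₂ _+_ (γ-≢ (W x z) ne) (γ-≢ (W z x) (ne ∘ sym)) ⟩
        s (W x z) + s (W z x) ≤⟨ +-mono-≤ (s≤6 (W x z)) (s≤6 (W z x)) ⟩
        12 ∎))
        where open ≤-Reasoning

      saving≤7d : saving M L ≤ 7 * d
      saving≤7d = ≤-trans (∑-mono M (λ { (a , b) → γ≤7 a b _ })) (≤-reflexive (trans (∑-const M 7) (*-comm d 7)))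

-- Numerical estimates

-- With ℓ loops at v, its elimination removes the penalty `P + Q + 7 * ℓ` and creates at most `G`;
-- the conclusions compare these two numbers.
module Estimates (k d ℓ P Q q G : ℕ) (2000≤k : 2000 ≤ k) (d+ℓ≡D : d + ℓ ≡ 100 * k) (2q≤k² : 2 * q ≤ k * k)
  (P≤6d : P ≤ 6 * d) (Q≤6d : Q ≤ 6 * d) (G≤7d : G ≤ 7 * d)
  (rows  : 36 * (d * G) ≤ 864 * q + 1008 * d + (P * (24 * (100 * k) + 72 + 6 * d) + Q * (36 * d + 12)))
  (cols  : 36 * (d * G) ≤ 864 * q + 1008 * d + (Q * (24 * (100 * k) + 72 + 6 * d) + P * (36 * d + 12)))
  (crude : 36 * (d * G) ≤ 864 * q + 1008 * d + (P * (42 * d) + Q * (36 * d + 12)))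
  (both  : 36 * (d * G) ≤ 864 * q + 1008 * d + 6 * (P * (2 * (100 * k) + 3 * Q + 8)) + 6 * (Q * (2 * (100 * k) + 3 * P + 8)))
  where

  open ≤-Reasoning

  d≤100k : d ≤ 100 * k
  d≤100k = ≤-trans (m≤m+n d ℓ) (≤-reflexive d+ℓ≡D)

  private
    864q : 864 * q ≤ 432 * (k * k)
    864q = ≤-trans (≤-reflexive (lem q)) (*-monoʳ-≤ 432 2q≤k²)
      where
      lem : ∀ q → 864 * q ≡ 432 * (2 * q)
      lem = solve-∀

    error : ∀ {R} → R ≤ 6 * d → 864 * q + 1008 * d + 12 * R ≤ 500 * (k * k)
    error {R} R≤ = begin
      864 * q + 1008 * d + 12 * R             ≤⟨ +-mono-≤ (+-monoˡ-≤ (1008 * d) 864q) (*-monoʳ-≤ 12 R≤) ⟩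
      432 * (k * k) + 1008 * d + 12 * (6 * d) ≡⟨ lem₁ (k * k) d ⟩
      432 * (k * k) + 1080 * d                ≤⟨ +-monoʳ-≤ (432 * (k * k)) (*-monoʳ-≤ 1080 d≤100k) ⟩
      432 * (k * k) + 1080 * (100 * k)        ≡⟨ lem₂ (k * k) k ⟩
      -- The threshold 2000 for k makes the linear error quadratic with a small constant: 1080 · 100
      -- = 54 · 2000.
      432 * (k * k) + 54 * (2000 * k)         ≤⟨ +-monoʳ-≤ (432 * (k * k)) (*-monoʳ-≤ 54 (*-monoˡ-≤ k 2000≤k)) ⟩
      432 * (k * k) + 54 * (k * k)            ≡⟨ sym (*-distribʳ-+ (k * k) 432 54) ⟩
      486 * (k * k)                           ≤⟨ *-monoˡ-≤ (k * k) (m≤m+n 486 14) ⟩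
      500 * (k * k)                           ∎
      where
      lem₁ : ∀ x d → 432 * x + 1008 * d + 12 * (6 * d) ≡ 432 * x + 1080 * d
      lem₁ = solve-∀
      lem₂ : ∀ x k → 432 * x + 1080 * (100 * k) ≡ 432 * x + 54 * (2000 * k)
      lem₂ = solve-∀

    cancel : ∀ {X Y} → 0 < d → 36 * (d * X) ≤ 36 * (d * Y) → X ≤ Y
    cancel {X} {Y} 0<d le = *-cancelˡ-≤ d {{>-nonZero 0<d}} (*-cancelˡ-≤ 36 le)

    -- β measures how far the coefficient of P lies below the break-even value 36 d. P and Q are
    -- rebound here so that the columns can be treated with the roles exchanged.
    gain : ∀ {P Q} β → Q ≤ 6 * d → 24 * (100 * k) + 72 + 6 * d + β ≤ 36 * d →
      36 * (d * G) ≤ 864 * q + 1008 * d + (P * (24 * (100 * k) + 72 + 6 * d) + Q * (36 * d + 12)) →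
      36 * (d * G) + P * β ≤ 500 * (k * k) + 36 * (d * (P + Q))
    gain {P} {Q} β Q≤ coeff le = begin
      36 * (d * G) + P * β
        ≤⟨ +-monoˡ-≤ (P * β) le ⟩
      864 * q + 1008 * d + (P * a + Q * (36 * d + 12)) + P * β
        ≡⟨ lem (864 * q + 1008 * d) P Q a β d ⟩
      864 * q + 1008 * d + 12 * Q + (P * (a + β) + 36 * (d * Q))
        ≤⟨ +-mono-≤ (error Q≤) (+-monoˡ-≤ (36 * (d * Q)) (*-monoʳ-≤ P coeff)) ⟩
      500 * (k * k) + (P * (36 * d) + 36 * (d * Q))
        ≡⟨ cong (500 * (k * k) +_) (lem' P Q d) ⟩
      500 * (k * k) + 36 * (d * (P + Q)) ∎
      where
      a = 24 * (100 * k) + 72 + 6 * d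
      lem : ∀ e P Q a b d → e + (P * a + Q * (36 * d + 12)) + P * b ≡ e + 12 * Q + (P * (a + b) + 36 * (d * Q))
      lem = solve-∀
      lem' : ∀ P Q d → P * (36 * d) + 36 * (d * Q) ≡ 36 * (d * (P + Q))
      lem' = solve-∀

    0<k : 0 < k
    0<k = ≤-trans (s≤s z≤n) 2000≤k

    72≤36k : 72 ≤ 36 * k
    72≤36k = ≤-trans (m≤m+n 72 71928) (*-monoʳ-≤ 36 2000≤k)

    const≤ : ∀ a → a ≤ 2000 → a ≤ k
    const≤ a h = ≤-trans h 2000≤k

    d-large : ∀ c → ℓ + c * k ≤ 100 * k → c * k ≤ d
    d-large c h = +-cancelʳ-≤ ℓ (c * k) d (≤-trans (≤-reflexive (+-comm (c * k) ℓ)) (≤-trans h (≤-reflexive (sym d+ℓ≡D))))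

  -- Now d ≥ 85 k, and 30 · 85 > 2400 keeps the coefficient of P at most 36 d, so only the error of
  -- order k is lost.
  low-ℓ : ℓ ≤ 15 * k → G ≤ P + Q + k
  low-ℓ hℓ = cancel (≤-trans 0<k (≤-trans (m≤m+n k (84 * k)) 85k≤d)) (begin
      36 * (d * G)                              ≡⟨ sym (trans (cong (36 * (d * G) +_) (*-zeroʳ P)) (+-identityʳ (36 * (d * G)))) ⟩
      36 * (d * G) + P * 0                      ≤⟨ gain 0 Q≤6d coeff rows ⟩
      500 * (k * k) + 36 * (d * (P + Q))        ≤⟨ +-monoˡ-≤ (36 * (d * (P + Q))) small ⟩
      36 * (d * k) + 36 * (d * (P + Q))         ≡⟨ lem d k (P + Q) ⟩
      36 * (d * (P + Q + k))                    ∎)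
    where
    85k≤d : 85 * k ≤ d
    85k≤d = d-large 85 (≤-trans (+-monoˡ-≤ (85 * k) hℓ) (≤-reflexive (sym (*-distribʳ-+ k 15 85))))
    lem : ∀ d k s → 36 * (d * k) + 36 * (d * s) ≡ 36 * (d * (s + k))
    lem = solve-∀
    small : 500 * (k * k) ≤ 36 * (d * k)
    small = begin
      500 * (k * k)       ≤⟨ *-monoˡ-≤ (k * k) (m≤m+n 500 2560) ⟩
      3060 * (k * k)      ≡⟨ eq k ⟩
      36 * (85 * k * k)   ≤⟨ *-monoʳ-≤ 36 (*-monoˡ-≤ k 85k≤d) ⟩
      36 * (d * k)        ∎
      where
      eq : ∀ k → 3060 * (k * k) ≡ 36 * (85 * k * k)
      eq = solve-∀
    coeff : 24 * (100 * k) + 72 + 6 * d + 0 ≤ 36 * d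
    coeff = begin
      24 * (100 * k) + 72 + 6 * d + 0 ≡⟨ eq₁ k d ⟩
      2400 * k + 72 + 6 * d           ≤⟨ +-monoˡ-≤ (6 * d) (+-monoʳ-≤ (2400 * k) 72≤36k) ⟩
      2400 * k + 36 * k + 6 * d       ≤⟨ +-monoˡ-≤ (6 * d) (≤-witness {2400 * k + 36 * k} (114 * k) (eq₂ k)) ⟩
      30 * (85 * k) + 6 * d           ≤⟨ +-monoˡ-≤ (6 * d) (*-monoʳ-≤ 30 85k≤d) ⟩
      30 * d + 6 * d                  ≡⟨ sym (*-distribʳ-+ d 30 6) ⟩
      36 * d                          ∎
      where
      eq₁ : ∀ k d → 24 * (100 * k) + 72 + 6 * d + 0 ≡ 2400 * k + 72 + 6 * d
      eq₁ = solve-∀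
      eq₂ : ∀ k → 30 * (85 * k) ≡ 2400 * k + 36 * k + 114 * k
      eq₂ = solve-∀

  -- The removed loops pay. Up to 15 k loops the loss k of `low-ℓ` is covered by 7 ℓ ≥ 7 k. Beyond
  -- that the crude bound loses d + 13 k, and d + 15 k ≤ 7 ℓ follows from 115 k ≤ 8 · 15 k by adding
  -- ℓ to both sides.
  large-ℓ : k ≤ ℓ → G + 2 * k ≤ P + Q + 7 * ℓ
  large-ℓ k≤ℓ with ≤-total ℓ (15 * k)
  ... | inj₁ hℓ = begin
      G + 2 * k           ≤⟨ +-monoˡ-≤ (2 * k) (low-ℓ hℓ) ⟩
      P + Q + k + 2 * k   ≡⟨ +-assoc (P + Q) k (2 * k) ⟩
      P + Q + 3 * k       ≤⟨ +-monoʳ-≤ (P + Q) (*-mono-≤ (m≤m+n 3 4) k≤ℓ) ⟩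
      P + Q + 7 * ℓ       ∎
  ... | inj₂ 15k≤ℓ with ≤-total k d
  -- For tiny d the error of order k k cannot be divided by d, but the trivial bound 7 d suffices.
  ... | inj₂ d≤k = begin
      G + 2 * k           ≤⟨ +-monoˡ-≤ (2 * k) (≤-trans G≤7d (*-monoʳ-≤ 7 d≤k)) ⟩
      7 * k + 2 * k       ≤⟨ ≤-witness {7 * k + 2 * k} (96 * k) (lem k) ⟩
      7 * (15 * k)        ≤⟨ *-monoʳ-≤ 7 15k≤ℓ ⟩
      7 * ℓ               ≤⟨ m≤n+m (7 * ℓ) (P + Q) ⟩
      P + Q + 7 * ℓ       ∎
    where
    lem : ∀ k → 7 * (15 * k) ≡ 7 * k + 2 * k + 96 * k
    lem = solve-∀
  ... | inj₁ k≤d = begin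
      G + 2 * k                     ≤⟨ +-monoˡ-≤ (2 * k) G≤ ⟩
      P + Q + d + 13 * k + 2 * k    ≡⟨ lem₁ (P + Q) d k ⟩
      P + Q + (d + 15 * k)          ≤⟨ +-monoʳ-≤ (P + Q) (+-cancelʳ-≤ ℓ (d + 15 * k) (7 * ℓ) bound) ⟩
      P + Q + 7 * ℓ                 ∎
    where
    lem₁ : ∀ s d k → s + d + 13 * k + 2 * k ≡ s + (d + 15 * k)
    lem₁ = solve-∀
    bound : d + 15 * k + ℓ ≤ 7 * ℓ + ℓ
    bound = begin
      d + 15 * k + ℓ       ≡⟨ trans (eq₁ d k ℓ) (cong (_+ 15 * k) d+ℓ≡D) ⟩
      100 * k + 15 * k     ≤⟨ ≤-witness {100 * k + 15 * k} (5 * k) (eq₂ k) ⟩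
      8 * (15 * k)         ≤⟨ *-monoʳ-≤ 8 15k≤ℓ ⟩
      8 * ℓ                ≡⟨ +-comm ℓ (7 * ℓ) ⟩
      7 * ℓ + ℓ            ∎
      where
      eq₁ : ∀ d k ℓ → d + 15 * k + ℓ ≡ d + ℓ + 15 * k
      eq₁ = solve-∀
      eq₂ : ∀ k → 8 * (15 * k) ≡ 100 * k + 15 * k + 5 * k
      eq₂ = solve-∀
    G≤ : G ≤ P + Q + d + 13 * k
    G≤ = cancel (≤-trans 0<k k≤d) (begin
      36 * (d * G)
        ≤⟨ crude ⟩
      864 * q + 1008 * d + (P * (42 * d) + Q * (36 * d + 12))
        ≡⟨ eq₁ (864 * q) d P Q ⟩
      864 * q + 1008 * d + 12 * Q + 6 * (P * d) + 36 * (d * (P + Q))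
        ≤⟨ +-monoˡ-≤ (36 * (d * (P + Q))) (+-mono-≤ (+-mono-≤ (+-monoˡ-≤ (1008 * d) 864q) (*-monoʳ-≤ 12 Q≤6d)) (*-monoʳ-≤ 6 (*-monoˡ-≤ d P≤6d))) ⟩
      432 * (k * k) + 1008 * d + 12 * (6 * d) + 6 * (6 * d * d) + 36 * (d * (P + Q))
        ≤⟨ +-monoˡ-≤ (36 * (d * (P + Q))) (+-monoˡ-≤ (6 * (6 * d * d)) (≤-trans (≤-reflexive (eq₂ (k * k) d))
             (+-mono-≤ (*-monoʳ-≤ 432 (*-monoˡ-≤ k k≤d)) (*-monoʳ-≤ 36 (*-monoʳ-≤ d (const≤ 30 (m≤m+n 30 1970))))))) ⟩
      432 * (d * k) + 36 * (d * k) + 6 * (6 * d * d) + 36 * (d * (P + Q))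
        ≡⟨ eq₃ d k (P + Q) ⟩
      36 * (d * (P + Q + d + 13 * k)) ∎)
      where
      eq₁ : ∀ e d P Q → e + 1008 * d + (P * (42 * d) + Q * (36 * d + 12)) ≡ e + 1008 * d + 12 * Q + 6 * (P * d) + 36 * (d * (P + Q))
      eq₁ = solve-∀
      eq₂ : ∀ x d → 432 * x + 1008 * d + 12 * (6 * d) ≡ 432 * x + 36 * (d * 30)
      eq₂ = solve-∀
      eq₃ : ∀ d k s → 432 * (d * k) + 36 * (d * k) + 6 * (6 * d * d) + 36 * (d * s) ≡ 36 * (d * (s + d + 13 * k))
      eq₃ = solve-∀

  private
    99k≤d : ℓ ≤ k → 99 * k ≤ d
    99k≤d h = d-large 99 (+-monoˡ-≤ (99 * k) h)

    -- From d ≥ 99 k: 30 · 99 - 2400 = 570, and the spare 10 k covers 72.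
    coeff₅₆₀ : ℓ ≤ k → 24 * (100 * k) + 72 + 6 * d + 560 * k ≤ 36 * d
    coeff₅₆₀ h = begin
      24 * (100 * k) + 72 + 6 * d + 560 * k ≡⟨ eq₁ k d ⟩
      2960 * k + 72 + 6 * d           ≤⟨ +-monoˡ-≤ (6 * d) (+-monoʳ-≤ (2960 * k) (const≤ 72 (m≤m+n 72 1928))) ⟩
      2960 * k + k + 6 * d            ≤⟨ +-monoˡ-≤ (6 * d) (≤-witness {2960 * k + k} (9 * k) (eq₂ k)) ⟩
      30 * (99 * k) + 6 * d           ≤⟨ +-monoˡ-≤ (6 * d) (*-monoʳ-≤ 30 (99k≤d h)) ⟩
      30 * d + 6 * d                  ≡⟨ sym (*-distribʳ-+ d 30 6) ⟩
      36 * d                          ∎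
      where
      eq₁ : ∀ k d → 24 * (100 * k) + 72 + 6 * d + 560 * k ≡ 2960 * k + 72 + 6 * d
      eq₁ = solve-∀
      eq₂ : ∀ k → 30 * (99 * k) ≡ 2960 * k + k + 9 * k
      eq₂ = solve-∀

    -- The surplus 560 k P pays for the error 500 k k and for the desired gain, 36 d t ≤ 3600 k t.
    heavy₁ : ∀ {P Q} t → ℓ ≤ k → Q ≤ 6 * d →
      36 * (d * G) ≤ 864 * q + 1008 * d + (P * (24 * (100 * k) + 72 + 6 * d) + Q * (36 * d + 12)) →
      3600 * t + 500 * k ≤ 560 * P → G + t ≤ P + Q
    heavy₁ {P} {Q} t h Q≤ le ht = cancel (≤-trans 0<k (≤-trans (m≤m+n k (98 * k)) (99k≤d h)))
      (+-cancelʳ-≤ (500 * (k * k)) (36 * (d * (G + t))) (36 * (d * (P + Q))) (begin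
        36 * (d * (G + t)) + 500 * (k * k)
          ≡⟨ eq₁ d G t (k * k) ⟩
        36 * (d * G) + (36 * (d * t) + 500 * (k * k))
          ≤⟨ +-monoʳ-≤ (36 * (d * G)) (+-monoˡ-≤ (500 * (k * k)) (*-monoʳ-≤ 36 (*-monoˡ-≤ t d≤100k))) ⟩
        36 * (d * G) + (36 * (100 * k * t) + 500 * (k * k))
          ≡⟨ cong (36 * (d * G) +_) (eq₂ k t) ⟩
        36 * (d * G) + k * (3600 * t + 500 * k)
          ≤⟨ +-monoʳ-≤ (36 * (d * G)) (*-monoʳ-≤ k ht) ⟩
        36 * (d * G) + k * (560 * P)
          ≡⟨ cong (36 * (d * G) +_) (eq₃ k P) ⟩
        36 * (d * G) + P * (560 * k)
          ≤⟨ gain (560 * k) Q≤ (coeff₅₆₀ h) le ⟩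
        500 * (k * k) + 36 * (d * (P + Q))
          ≡⟨ +-comm (500 * (k * k)) (36 * (d * (P + Q))) ⟩
        36 * (d * (P + Q)) + 500 * (k * k) ∎))
      where
      eq₁ : ∀ d G t x → 36 * (d * (G + t)) + 500 * x ≡ 36 * (d * G) + (36 * (d * t) + 500 * x)
      eq₁ = solve-∀
      eq₂ : ∀ k t → 36 * (100 * k * t) + 500 * (k * k) ≡ k * (3600 * t + 500 * k)
      eq₂ = solve-∀
      eq₃ : ∀ k P → k * (560 * P) ≡ P * (560 * k)
      eq₃ = solve-∀

    heavy : ∀ t → ℓ ≤ k → (3600 * t + 500 * k ≤ 560 * P) ⊎ (3600 * t + 500 * k ≤ 560 * Q) → G + t ≤ P + Q
    heavy t h (inj₁ hP) = heavy₁ t h Q≤6d rows hP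
    heavy t h (inj₂ hQ) = ≤-trans (heavy₁ t h P≤6d cols hQ) (≤-reflexive (+-comm Q P))

    t≤560 : ∀ a b {R} → 3600 * a + 500 ≤ 560 * b → b * k ≤ R → 3600 * (a * k) + 500 * k ≤ 560 * R
    t≤560 a b {R} le hR = begin
      3600 * (a * k) + 500 * k ≡⟨ eq a k ⟩
      (3600 * a + 500) * k     ≤⟨ *-monoˡ-≤ k le ⟩
      560 * b * k              ≡⟨ *-assoc 560 b k ⟩
      560 * (b * k)            ≤⟨ *-monoʳ-≤ 560 hR ⟩
      560 * R                  ∎
      where
      eq : ∀ a k → 3600 * (a * k) + 500 * k ≡ (3600 * a + 500) * k
      eq = solve-∀

    one-half : ∀ {a b c} → 2 * c ≤ a + b → (c ≤ a) ⊎ (c ≤ b)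
    one-half {a} {b} {c} h with ≤-total c a | ≤-total c b
    ... | inj₁ x | _ = inj₁ x
    ... | _ | inj₁ x = inj₂ x
    ... | inj₂ a≤c | inj₂ b≤c with m≤n⇒m<n∨m≡n a≤c
    ...   | inj₂ refl = inj₁ ≤-refl
    ...   | inj₁ a<c = ⊥-elim (<⇒≱ (+-mono-<-≤ a<c b≤c) (≤-trans (≤-reflexive (cong (c +_) (sym (+-identityʳ c)))) h))

    -- 7 · 99 - 400 - 5 = 288 = 3 · 96, where 5 k absorbs the 16.
    looped-heavy : ℓ ≤ k → 7 * d ≤ 4 * (100 * k) + 3 * (P + Q) + 16 → 2 * (48 * k) ≤ P + Q
    looped-heavy h hd = *-cancelˡ-≤ 3 (+-cancelˡ-≤ (405 * k) (3 * (2 * (48 * k))) (3 * (P + Q)) (begin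
      405 * k + 3 * (2 * (48 * k))          ≡⟨ eq₁ k ⟩
      7 * (99 * k)                          ≤⟨ *-monoʳ-≤ 7 (99k≤d h) ⟩
      7 * d                                 ≤⟨ hd ⟩
      4 * (100 * k) + 3 * (P + Q) + 16      ≤⟨ +-monoʳ-≤ (4 * (100 * k) + 3 * (P + Q)) (≤-trans (const≤ 16 (m≤m+n 16 1984)) (m≤m+n k (4 * k))) ⟩
      4 * (100 * k) + 3 * (P + Q) + 5 * k   ≡⟨ eq₂ k (P + Q) ⟩
      405 * k + 3 * (P + Q)                 ∎))
      where
      eq₁ : ∀ k → 405 * k + 3 * (2 * (48 * k)) ≡ 7 * (99 * k)
      eq₁ = solve-∀
      eq₂ : ∀ k s → 4 * (100 * k) + 3 * s + 5 * k ≡ 405 * k + 3 * s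
      eq₂ = solve-∀

  looped : ℓ ≤ k → 7 * d ≤ 4 * (100 * k) + 3 * (P + Q) + 16 → G + 5 * k ≤ P + Q
  looped h hd = heavy (5 * k) h ([ (λ x → inj₁ (t≤560 5 48 (m≤m+n 18500 8380) x)) , (λ x → inj₂ (t≤560 5 48 (m≤m+n 18500 8380) x)) ]′
                  (one-half {P} {Q} (looped-heavy h hd)))

  private
    -- Both row and column bounds are at most 243 k, so P + Q gets the factor 6 · 243 = 1458 instead
    -- of 3600. The difference, applied to P + Q ≥ 3.8 k, exceeds 7700 k k, made of 500 for the
    -- error and 7200 for the gain 2 k.
    light-gain : ℓ ≡ 0 → 38 * k ≤ 10 * (P + Q) → P ≤ 14 * k → Q ≤ 14 * k → G + 2 * k ≤ P + Q
    light-gain ℓ≡0 hS P≤ Q≤ = cancel (≤-trans 0<k (≤-trans (m≤m+n k (98 * k)) (99k≤d (≤-trans (≤-reflexive ℓ≡0) z≤n)))) (begin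
        36 * (d * (G + 2 * k))
          ≡⟨ eq₁ d G k ⟩
        36 * (d * G) + 72 * (d * k)
          ≤⟨ +-mono-≤ both (*-monoʳ-≤ 72 (*-monoˡ-≤ k d≤100k)) ⟩
        864 * q + 1008 * d + 6 * (P * (2 * (100 * k) + 3 * Q + 8)) + 6 * (Q * (2 * (100 * k) + 3 * P + 8)) + 72 * (100 * k * k)
          ≤⟨ +-monoˡ-≤ (72 * (100 * k * k)) (+-mono-≤ (+-mono-≤ (≤-trans (m≤m+n (864 * q + 1008 * d) (12 * P)) (error P≤6d))
               (*-monoʳ-≤ 6 (*-monoʳ-≤ P (side Q≤)))) (*-monoʳ-≤ 6 (*-monoʳ-≤ Q (side P≤)))) ⟩
        500 * (k * k) + 6 * (P * (243 * k)) + 6 * (Q * (243 * k)) + 72 * (100 * k * k)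
          ≡⟨ eq₂ k P Q ⟩
        1458 * (k * (P + Q)) + 7700 * (k * k)
          ≤⟨ +-monoʳ-≤ (1458 * (k * (P + Q))) (begin
            7700 * (k * k)              ≤⟨ *-monoˡ-≤ (k * k) (m≤m+n 7700 432) ⟩
            8132 * (k * k)              ≡⟨ eq₃ k ⟩
            214 * (k * (38 * k))        ≤⟨ *-monoʳ-≤ 214 (*-monoʳ-≤ k hS) ⟩
            214 * (k * (10 * (P + Q)))  ≡⟨ eq₄ k (P + Q) ⟩
            2140 * (k * (P + Q))        ∎) ⟩
        1458 * (k * (P + Q)) + 2140 * (k * (P + Q))
          ≡⟨ sym (*-distribʳ-+ (k * (P + Q)) 1458 2140) ⟩
        3598 * (k * (P + Q))
          ≤⟨ *-monoˡ-≤ (k * (P + Q)) (m≤m+n 3598 2) ⟩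
        3600 * (k * (P + Q))
          ≡⟨ eq₅ k (P + Q) ⟩
        36 * (100 * k * (P + Q))
          ≡⟨ cong (λ t → 36 * (t * (P + Q))) (trans (sym d+ℓ≡D) (trans (cong (d +_) ℓ≡0) (+-identityʳ d))) ⟩
        36 * (d * (P + Q)) ∎)
      where
      side : ∀ {R} → R ≤ 14 * k → 2 * (100 * k) + 3 * R + 8 ≤ 243 * k
      side {R} hR = begin
        2 * (100 * k) + 3 * R + 8       ≤⟨ +-mono-≤ (+-monoʳ-≤ (2 * (100 * k)) (*-monoʳ-≤ 3 hR)) (const≤ 8 (m≤m+n 8 1992)) ⟩
        2 * (100 * k) + 3 * (14 * k) + k ≡⟨ eq k ⟩
        243 * k                          ∎
        where
        eq : ∀ k → 2 * (100 * k) + 3 * (14 * k) + k ≡ 243 * k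
        eq = solve-∀
      eq₁ : ∀ d G k → 36 * (d * (G + 2 * k)) ≡ 36 * (d * G) + 72 * (d * k)
      eq₁ = solve-∀
      eq₂ : ∀ k P Q → 500 * (k * k) + 6 * (P * (243 * k)) + 6 * (Q * (243 * k)) + 72 * (100 * k * k) ≡ 1458 * (k * (P + Q)) + 7700 * (k * k)
      eq₂ = solve-∀
      eq₃ : ∀ k → 8132 * (k * k) ≡ 214 * (k * (38 * k))
      eq₃ = solve-∀
      eq₄ : ∀ k s → 214 * (k * (10 * s)) ≡ 2140 * (k * s)
      eq₄ = solve-∀
      eq₅ : ∀ k s → 3600 * (k * s) ≡ 36 * (100 * k * s)
      eq₅ = solve-∀

  -- From 14 k on one heavy side is enough, as 3600 · 2 + 500 ≤ 560 · 14; below, the symmetric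
  -- estimate takes over.
  loopless-gain : ℓ ≡ 0 → 38 * k ≤ 10 * (P + Q) → G + 2 * k ≤ P + Q
  loopless-gain ℓ≡0 hS with ≤-total (14 * k) P | ≤-total (14 * k) Q
  ... | inj₁ x  | _       = heavy (2 * k) (≤-trans (≤-reflexive ℓ≡0) z≤n) (inj₁ (t≤560 2 14 (m≤m+n 7700 140) x))
  ... | inj₂ _  | inj₁ x  = heavy (2 * k) (≤-trans (≤-reflexive ℓ≡0) z≤n) (inj₂ (t≤560 2 14 (m≤m+n 7700 140) x))
  ... | inj₂ P≤ | inj₂ Q≤ = light-gain ℓ≡0 hS P≤ Q≤

-- Edge-disjoint walks and immersions

unique-↭ : ∀ {A : Set} {xs ys : List A} → xs ↭ ys → Unique xs → Unique ys
unique-↭ {A} p = Permₛ.Unique-resp-↭ (setoid A) (↭⇒↭ₛ p)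

unique-++ʳ : ∀ {A : Set} (xs : List A) {ys} → Unique (xs ++ ys) → Unique ys
unique-++ʳ []       u       = u
unique-++ʳ (x ∷ xs) (_ ∷ u) = unique-++ʳ xs u

unique-disjoint : ∀ {A : Set} (xs : List A) {ys x} → Unique (xs ++ ys) → x ∈ xs → x ∉ ys
unique-disjoint (x ∷ xs) (x∉ ∷ u) (here refl) m = All.lookup x∉ (∈-++⁺ʳ xs m) refl
unique-disjoint (x ∷ xs) (_ ∷ u)  (there m')  m = unique-disjoint xs u m' m

lookup-injective : ∀ {A : Set} {xs : List A} → Unique xs → ∀ {i j} → lookup xs i ≡ lookup xs j → i ≡ j
lookup-injective (x∉ ∷ u) {zero}  {zero}  eq = refl
lookup-injective (x∉ ∷ u) {zero}  {suc j} eq = ⊥-elim (All.lookup x∉ (∈-lookup j) eq)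
lookup-injective (x∉ ∷ u) {suc i} {zero}  eq = ⊥-elim (All.lookup x∉ (∈-lookup i) (sym eq))
lookup-injective (x∉ ∷ u) {suc i} {suc j} eq = cong suc (lookup-injective u eq)

module Routing (G : Digraph) where

  E : Set
  E = Fin (n G) × Fin (n G)

  infixr 5 _·_
  _·_ : ∀ {x y z} → Walk G x y → Walk G y z → Walk G x z
  stop     · W' = W'
  step e W · W' = step e (W · W')

  walkEdges-· : ∀ {x y z} (W : Walk G x y) (W' : Walk G y z) → walkEdges (W · W') ≡ walkEdges W ++ walkEdges W'
  walkEdges-· stop       W' = refl
  walkEdges-· (step e W) W' = cong (_ ∷_) (walkEdges-· W W')

  suffix : ∀ {x y z} (W : Walk G y z) → Unique (walkVertices W) → x ∈ walkVertices W →
           Σ (Walk G x z) λ W' → Unique (walkVertices W') × (∀ {e} → e ∈ walkEdges W' → e ∈ walkEdges W)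
  suffix stop       u       (here refl) = stop , u , λ m → m
  suffix (step e W) u       (here refl) = step e W , u , λ m → m
  suffix (step e W) (_ ∷ u) (there m) with suffix W u m
  ... | W' , u' , sub = W' , u' , there ∘ sub

  open import Data.List.Membership.DecPropositional (Fin._≟_ {n G}) using (_∈?_)

  -- Loop erasure: when the start reappears, everything before its reappearance is cut. Edges are
  -- only dropped, so disjointness survives.
  shorten : ∀ {x y} (W : Walk G x y) → Σ (Path G x y) λ P → ∀ {e} → e ∈ pathEdges P → e ∈ walkEdges W
  shorten stop = record { walk = stop ; distinct = [] ∷ [] } , λ m → m
  shorten {x} (step e W) with shorten W
  ... | P , sub with x ∈? walkVertices (walk P)
  ... | no x∉ = record { walk = step e (walk P) ; distinct = All.tabulate (λ m eq → x∉ (subst (_∈ _) (sym eq) m)) ∷ distinct P } ,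
                λ { (here eq) → here eq ; (there m) → there (sub m) }
  ... | yes x∈ with suffix (walk P) (distinct P) x∈
  ... | W' , u' , sub' = record { walk = W' ; distinct = u' } , there ∘ sub ∘ sub'

  -- The second index concatenates the edges of all walks, so that edge-disjointness is uniqueness
  -- in one list and is carried along by permutations.
  data Threads : List E → List E → Set where
    []  : Threads [] []
    _∷_ : ∀ {x y L es} (W : Walk G x y) → Threads L es → Threads ((x , y) ∷ L) (walkEdges W ++ es)

  -- L lists the endpoint pairs of a family of pairwise edge-disjoint walks of G.
  Realizable : List E → Set
  Realizable L = Σ (List E) λ es → Threads L es × Unique es

  threads-↭ : ∀ {L L' es} → L ↭ L' → Threads L es → ∃ λ es' → (es ↭ es') × Threads L' es'
  threads-↭ refl ts = _ , ↭-refl , ts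
  threads-↭ (prep _ p) (W ∷ ts) with threads-↭ p ts
  ... | es' , q , ts' = _ , ++⁺ˡ (walkEdges W) q , W ∷ ts'
  threads-↭ (swap _ _ p) (W ∷ (W' ∷ ts)) with threads-↭ p ts
  ... | es' , q , ts' = _ , ↭-trans (shifts (walkEdges W) (walkEdges W')) (++⁺ˡ (walkEdges W') (++⁺ˡ (walkEdges W) q)) , W' ∷ (W ∷ ts')
  threads-↭ (step↭ p p') ts with threads-↭ p ts
  ... | es' , q , ts' with threads-↭ p' ts'
  ... | es'' , q' , ts'' = es'' , ↭-trans q q' , ts''

  realizable-↭ : ∀ {L L'} → L ↭ L' → Realizable L → Realizable L'
  realizable-↭ p (es , ts , u) with threads-↭ p ts
  ... | es' , q , ts' = es' , ts' , unique-↭ q u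

  realizable-tail : ∀ {e L} → Realizable (e ∷ L) → Realizable L
  realizable-tail (_ , W ∷ ts , u) = _ , ts , unique-++ʳ (walkEdges W) u

  realizable-lift : ∀ {x v y L} → Realizable ((x , v) ∷ (v , y) ∷ L) → Realizable ((x , y) ∷ L)
  realizable-lift (_ , W ∷ (W' ∷ ts) , u) = _ , (W · W') ∷ ts ,
    subst Unique (sym (trans (cong (_++ _) (walkEdges-· W W')) (++-assoc (walkEdges W) (walkEdges W') _))) u

  thread : ∀ {x y L es} → Threads L es → (x , y) ∈ L → Walk G x y
  thread (W ∷ ts) (here refl) = W
  thread (W ∷ ts) (there m)   = thread ts m

  thread-⊆ : ∀ {x y L es} (ts : Threads L es) (m : (x , y) ∈ L) → ∀ {e} → e ∈ walkEdges (thread ts m) → e ∈ es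
  thread-⊆ (W ∷ ts) (here refl) me = ∈-++⁺ˡ me
  thread-⊆ (W ∷ ts) (there m)   me = ∈-++⁺ʳ (walkEdges W) (thread-⊆ ts m me)

  thread-disjoint : ∀ {x y x' y' L es} (ts : Threads L es) → Unique es → (m : (x , y) ∈ L) (m' : (x' , y') ∈ L) →
    (x , y) ≢ (x' , y') → ∀ {e} → e ∈ walkEdges (thread ts m) → e ∉ walkEdges (thread ts m')
  thread-disjoint (W ∷ ts) u (here refl) (here refl) ne me me' = ne refl
  thread-disjoint (W ∷ ts) u (here refl) (there m')  ne me me' = unique-disjoint (walkEdges W) u me (thread-⊆ ts m' me')
  thread-disjoint (W ∷ ts) u (there m)   (here refl) ne me me' = unique-disjoint (walkEdges W) u me' (thread-⊆ ts m me)
  thread-disjoint (W ∷ ts) u (there m)   (there m')  ne me me' = thread-disjoint ts (unique-++ʳ (walkEdges W) u) m m' ne me me'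

-- Reading total off edgeCount by unification exposes the recursion local to edgeCount.
mutual
  total : (G : Digraph) (m : ℕ) → (Fin m → ℕ) → ℕ
  total = _

  edgeCount≡total : ∀ G → edgeCount G ≡ total G (n G) (outdeg G)
  edgeCount≡total G with n G | outdeg G
  ... | m | f = refl

total≡∑ : ∀ {A : Set} G (xs : List A) (h : A → ℕ) (f : Fin (length xs) → ℕ) → (∀ i → f i ≡ h (lookup xs i)) →
          total G (length xs) f ≡ ∑ xs h
total≡∑ G []       h f eq = refl
total≡∑ G (x ∷ xs) h f eq = cong₂ _+_ (eq zero) (total≡∑ G xs h (f ∘ suc) (eq ∘ suc))

countT≡∑ : ∀ {A : Set} (xs : List A) (h : A → ℕ) (b : Fin (length xs) → Bool) →
           (∀ i → (if b i then 1 else 0) ≡ h (lookup xs i)) → countT b ≡ ∑ xs h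
countT≡∑ []       h b eq = refl
countT≡∑ (x ∷ xs) h b eq = cong₂ _+_ (eq zero) (countT≡∑ xs h (b ∘ suc) (eq ∘ suc))

-- Immersed simple digraphs from realizable lists

module Dense (G : Digraph) where
  open Routing G
  open Counting (Fin._≟_ {n G})
  open Bilinear (Fin._≟_ {n G})

  positive : ℕ → Bool
  positive zero    = false
  positive (suc _) = true

  arc-refl : ∀ L x → arc L x x ≡ 0
  arc-refl L x with x Fin.≟ x
  ... | yes _ = refl
  ... | no ne = ⊥-elim (ne refl)

  positive-arc : ∀ L x y → (if positive (arc L x y) then 1 else 0) ≡ arc L x y
  positive-arc L x y with x Fin.≟ y
  ... | yes _ = refl
  ... | no _ with w L x y
  ...   | zero  = refl
  ...   | suc _ = refl

  arc⇒∈ : ∀ L x y → positive (arc L x y) ≡ true → (x , y) ∈ L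
  arc⇒∈ L x y eq with x Fin.≟ y
  ... | no _ = w-≥1⁻ L (lem eq)
    where
    lem : ∀ {k} → positive (pos k) ≡ true → 1 ≤ k
    lem {suc k} _ = s≤s z≤n

  immersed : List E → List (Fin (n G)) → Digraph
  immersed L S = record
    { n = length S
    ; adj = λ i j → positive (arc L (lookup S i) (lookup S j))
    ; loopless = λ i → cong positive (arc-refl L (lookup S i)) }

  edgeCount-immersed : ∀ L S → edgeCount (immersed L S) ≡ ∑ S (λ x → ∑ S (arc L x))
  edgeCount-immersed L S = trans (edgeCount≡total (immersed L S))
    (total≡∑ (immersed L S) S _ _ (λ i → countT≡∑ S (arc L (lookup S i)) _ (λ j → positive-arc L (lookup S i) (lookup S j))))

  immerses : ∀ {L S} → Realizable L → Unique S → Immerses G (immersed L S)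
  immerses {L} {S} (es , ts , u) uS = lookup S , lookup-injective uS ,
    (λ i j e → proj₁ (route i j e)) ,
    λ i j i' j' e e' ne a b m m' → thread-disjoint ts u (mem i j e) (mem i' j' e')
      (λ eq → ne (cong₂ _,_ (lookup-injective uS (cong proj₁ eq)) (lookup-injective uS (cong proj₂ eq))))
      (proj₂ (route i j e) m) (proj₂ (route i' j' e') m')
    where
    mem : ∀ i j → positive (arc L (lookup S i) (lookup S j)) ≡ true → (lookup S i , lookup S j) ∈ L
    mem i j e = arc⇒∈ L (lookup S i) (lookup S j) e
    route : ∀ i j e → Σ (Path G (lookup S i) (lookup S j)) λ P → ∀ {e'} → e' ∈ pathEdges P → e' ∈ walkEdges (thread ts (mem i j e))
    route i j e = shorten (thread ts (mem i j e))

  DenseImmersion : ℕ → Set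
  DenseImmersion k = Σ Digraph λ H → n H ≤ 200 * k × k * k ≤ 2 * edgeCount H × Immerses G H

  dense : ∀ {k L S} → Realizable L → Unique S → length S ≤ 200 * k →
          k * k ≤ 2 * ∑ S (λ x → ∑ S (arc L x)) → DenseImmersion k
  dense {k} {L} {S} re uS small many = immersed L S , small ,
    ≤-trans many (≤-reflexive (cong (2 *_) (sym (edgeCount-immersed L S)))) , immerses re uS

-- Eliminating a vertex

∑-replicate : ∀ {A : Set} m (x : A) f → ∑ (replicate m x) f ≡ m * f x
∑-replicate zero    x f = refl
∑-replicate (suc m) x f = cong (f x +_) (∑-replicate m x f)

∑-filter : ∀ {A : Set} {P : A → Set} (P? : Decidable P) xs {f : A → ℕ} → (∀ x → ¬ P x → f x ≡ 0) →
           ∑ xs f ≡ ∑ (filter P? xs) f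
∑-filter P? [] h = refl
∑-filter P? (x ∷ xs) {f} h with P? x
... | yes _ = cong (f x +_) (∑-filter P? xs h)
... | no ¬p = trans (cong (_+ ∑ xs f) (h x ¬p)) (∑-filter P? xs h)

length-filter≤∑ : ∀ {A : Set} {P : A → Set} (P? : Decidable P) xs {f : A → ℕ} → (∀ x → P x → 1 ≤ f x) →
                  length (filter P? xs) ≤ ∑ xs f
length-filter≤∑ P? [] h = z≤n
length-filter≤∑ P? (x ∷ xs) {f} h with P? x
... | yes px = +-mono-≤ (h x px) (length-filter≤∑ P? xs h)
... | no _   = ≤-trans (length-filter≤∑ P? xs h) (m≤n+m (∑ xs f) (f x))

module Elimination (G : Digraph) where
  open Routing G
  open Dense G
  open Counting (Fin._≟_ {n G})
  open Bilinear (Fin._≟_ {n G})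

  V : Set
  V = Fin (n G)

  record State (D : ℕ) (U : List V) (L : List E) : Set where
    field
      unique     : Unique U
      within     : Within U L
      out≡D      : ∀ {x} → x ∈ U → out L x ≡ D
      inn≡D      : ∀ {x} → x ∈ U → inn L x ≡ D
      realizable : Realizable L
  open State

  Φ-↭ᵛ : ∀ {U U'} L → U ↭ U' → Φ U L ≡ Φ U' L
  Φ-↭ᵛ {U} {U'} L p = trans (∑-↭ _ p) (∑-cong U' (λ x → ∑-↭ (λ y → ψ x y (w L x y)) p))

  arcs-between : List V → List V → List V → List E → ℕ
  arcs-between U X Y L = ∑ U (λ x → ∑ U (λ y → pos (cnt X x) * (pos (cnt Y y) * arc L x y)))

  -- Restricting to the vertices that occur in X or Y loses none of the counted edges and leaves at
  -- most 200 k vertices, however large U is.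
  dense-between : ∀ {k U X Y L} → Realizable L → Unique U →
    (∀ {x} → x ∈ X → x ∈ U) → (∀ {y} → y ∈ Y → y ∈ U) → length X ≤ 100 * k → length Y ≤ 100 * k →
    k * k ≤ 2 * arcs-between U X Y L → DenseImmersion k
  dense-between {k} {U} {X} {Y} {L} re u X⊆ Y⊆ |X|≤ |Y|≤ le = dense {k} {L} {S} re (filter⁺ touched? u)
      (≤-trans (length-filter≤∑ touched? U (λ _ t → t)) (begin
        ∑ U (λ x → p x + r x)   ≡⟨ trans (∑-+ U p r) (cong₂ _+_ (∑-cnt≡length X u X⊆) (∑-cnt≡length Y u Y⊆)) ⟩
        length X + length Y     ≤⟨ +-mono-≤ |X|≤ |Y|≤ ⟩
        100 * k + 100 * k       ≡⟨ sym (*-distribʳ-+ k 100 100) ⟩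
        200 * k                 ∎))
      (≤-trans le (*-monoʳ-≤ 2 (begin
        ∑ U (λ x → ∑ U (h x))   ≡⟨ ∑-cong U (λ x → ∑-filter touched? U (λ y ¬t → h-zeroʳ x y (untouched y ¬t))) ⟩
        ∑ U (λ x → ∑ S (h x))   ≡⟨ ∑-filter touched? U (λ x ¬t → trans (∑-cong S (λ y → cong (λ t → pos t * (pos (r y) * arc L x y)) (m+n≡0⇒m≡0 (p x) (untouched x ¬t)))) (∑-zero S)) ⟩
        ∑ S (λ x → ∑ S (h x))   ≤⟨ ∑-mono S (λ x → ∑-mono S (λ y → drop-pos (p x) (r y) (arc L x y))) ⟩
        ∑ S (λ x → ∑ S (arc L x)) ∎)))
    where
    open ≤-Reasoning
    p r : V → ℕ
    p = cnt X
    r = cnt Y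
    h : V → V → ℕ
    h x y = pos (p x) * (pos (r y) * arc L x y)
    touched? : Decidable (λ x → 1 ≤ p x + r x)
    touched? x = 1 ≤? p x + r x
    S = filter touched? U
    untouched : ∀ x → ¬ (1 ≤ p x + r x) → p x + r x ≡ 0
    untouched x ¬t = n<1⇒n≡0 (≰⇒> ¬t)
    h-zeroʳ : ∀ x y → p y + r y ≡ 0 → h x y ≡ 0
    h-zeroʳ x y eq = trans (cong (λ t → pos (p x) * (pos t * arc L x y)) (m+n≡0⇒n≡0 (p y) eq)) (*-zeroʳ (pos (p x)))
    pos≤1 : ∀ t → pos t ≤ 1
    pos≤1 zero = z≤n
    pos≤1 (suc _) = ≤-refl
    drop-pos : ∀ a b t → pos a * (pos b * t) ≤ t
    drop-pos a b t = ≤-trans (*-mono-≤ (pos≤1 a) (*-monoˡ-≤ t (pos≤1 b))) (≤-reflexive (trans (+-identityʳ (1 * t)) (+-identityʳ t)))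

  -- A loop enters both sums, so that the loads add up to exactly 2 Φ.
  load : List V → List E → V → ℕ
  load U L v = ∑ U (λ y → ψ v y (w L v y)) + ∑ U (λ x → ψ x v (w L x v))

  module _ (v : V) where

    Avoids : E → Set
    Avoids (a , b) = a ≢ v × b ≢ v

    -- Undoes the lifting at v. Pairings of the same in-edges and out-edges have the same expansion
    -- up to permutation, which makes it an invariant of swaps.
    expand : List E → List E
    expand []            = []
    expand ((x , y) ∷ M) = (x , v) ∷ (v , y) ∷ expand M

    expand-↭ : ∀ {M M'} → M ↭ M' → expand M ↭ expand M'
    expand-↭ refl = ↭-refl
    expand-↭ (prep (x , y) p) = prep _ (prep _ (expand-↭ p))
    expand-↭ (swap (x , y) (x' , y') p) =
      ↭-trans (shifts ((x , v) ∷ (v , y) ∷ []) ((x' , v) ∷ (v , y') ∷ []))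
              (prep _ (prep _ (prep _ (prep _ (expand-↭ p)))))
    expand-↭ (step↭ p q) = ↭-trans (expand-↭ p) (expand-↭ q)

    expand-swap : ∀ a b a' b' R → expand ((a , b) ∷ (a' , b') ∷ R) ↭ expand ((a , b') ∷ (a' , b) ∷ R)
    expand-swap a b a' b' R = prep _ (↭-trans (prep _ (swap _ _ ↭-refl)) (↭-trans (swap _ _ ↭-refl) (prep _ (swap _ _ ↭-refl))))

    ∑-expand : ∀ M (f : E → ℕ) → ∑ (expand M) f ≡ ∑ M (λ e → f (proj₁ e , v) + f (v , proj₂ e))
    ∑-expand [] f = refl
    ∑-expand ((x , y) ∷ M) f = trans (cong (λ t → f (x , v) + (f (v , y) + t)) (∑-expand M f)) (sym (+-assoc (f (x , v)) _ _))

    expand-∈ : ∀ {M a b} → (a , b) ∈ M → (a , v) ∈ expand M × (v , b) ∈ expand M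
    expand-∈ (here refl) = here refl , there (here refl)
    expand-∈ {(x , y) ∷ M} (there m) with expand-∈ m
    ... | i , j = there (there i) , there (there j)

    realizable-expand : ∀ M R → Realizable (expand M ++ R) → Realizable (M ++ R)
    realizable-expand [] R re = re
    realizable-expand ((x , y) ∷ M) R re = realizable-↭ (shift (x , y) M R)
      (realizable-expand M ((x , y) ∷ R) (realizable-↭ (↭-sym (shift (x , y) (expand M) R)) (realizable-lift re)))

    realizable-drop : ∀ ℓ {e R} → Realizable (replicate ℓ e ++ R) → Realizable R
    realizable-drop zero    re = re
    realizable-drop (suc ℓ) re = realizable-drop ℓ (realizable-tail re)

    record Split (L : List E) : Set where
      constructor mkSplit
      field
        ins outs : List V
        ℓ        : ℕ
        rest     : List E
        eq       : L ↭ replicate ℓ (v , v) ++ map (_, v) ins ++ map (v ,_) outs ++ rest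
        ins≢     : All (_≢ v) ins
        outs≢    : All (_≢ v) outs
        rest≢    : All Avoids rest

    split : ∀ L → Split L
    split [] = mkSplit [] [] 0 [] ↭-refl [] [] []
    split ((a , b) ∷ L) with split L | a Fin.≟ v | b Fin.≟ v
    ... | mkSplit i o ℓ r eq i≢ o≢ r≢ | yes refl | yes refl = mkSplit i o (suc ℓ) r (prep _ eq) i≢ o≢ r≢
    ... | mkSplit i o ℓ r eq i≢ o≢ r≢ | no a≢    | yes refl = mkSplit (a ∷ i) o ℓ r
          (↭-trans (prep _ eq) (↭-sym (shift _ (replicate ℓ (v , v)) _))) (a≢ ∷ i≢) o≢ r≢
    ... | mkSplit i o ℓ r eq i≢ o≢ r≢ | yes refl | no b≢    = mkSplit i (b ∷ o) ℓ r
          (↭-trans (prep _ eq) (↭-sym (↭-trans (++⁺ˡ (replicate ℓ (v , v)) (shift _ (map (_, v) i) _)) (shift _ (replicate ℓ (v , v)) _)))) i≢ (b≢ ∷ o≢) r≢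
    ... | mkSplit i o ℓ r eq i≢ o≢ r≢ | no a≢    | no b≢    = mkSplit i o ℓ ((a , b) ∷ r)
          (↭-trans (prep _ eq) (↭-sym (↭-trans (++⁺ˡ (replicate ℓ (v , v))
            (↭-trans (++⁺ˡ (map (_, v) i) (shift _ (map (v ,_) o) r)) (shift _ (map (_, v) i) _))) (shift _ (replicate ℓ (v , v)) _))))
          i≢ o≢ ((a≢ , b≢) ∷ r≢)

    -- Any initial pairing will do, as swaps improve it afterwards.
    pair-up : ∀ ins outs → length ins ≡ length outs → All (_≢ v) ins → All (_≢ v) outs →
              ∃ λ M → (map (_, v) ins ++ map (v ,_) outs ↭ expand M) × All Avoids M
    pair-up []       []       _  _ _ = [] , ↭-refl , []
    pair-up (x ∷ xs) (y ∷ ys) eq (x≢ ∷ i≢) (y≢ ∷ o≢) with pair-up xs ys (suc-injective eq) i≢ o≢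
    ... | M , p , av = (x , y) ∷ M , prep _ (↭-trans (shift _ (map (_, v) xs) _) (prep _ p)) , (x≢ , y≢) ∷ av

    module _ {ℓ : ℕ} {L : List E} (M R : List E) (eq : L ↭ replicate ℓ (v , v) ++ expand M ++ R)
             (avM : All Avoids M) (avR : All Avoids R) where

      ∑-split : ∀ (f : E → ℕ) → ∑ L f ≡ ℓ * f (v , v) + (∑ M (λ e → f (proj₁ e , v) + f (v , proj₂ e)) + ∑ R f)
      ∑-split f = trans (∑-↭ f eq) (trans (∑-++ (replicate ℓ (v , v)) _ f)
        (cong₂ _+_ (∑-replicate ℓ (v , v) f) (trans (∑-++ (expand M) R f) (cong (_+ ∑ R f) (∑-expand M f)))))

      private
        vanish : ∀ {xs : List E} (f : E → ℕ) → (∀ e → e ∈ xs → f e ≡ 0) → ∑ xs f ≡ 0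
        vanish {xs} f h = trans (∑-cong∈ xs h) (∑-zero xs)

        assemble : ∀ {a b b' c c'} → a ≡ 0 → b ≡ b' → c ≡ c' → a + (b + c) ≡ b' + c'
        assemble refl refl refl = refl

      w-off : ∀ {x y} → x ≢ v → y ≢ v → w L x y ≡ w R x y
      w-off {x} {y} x≢ y≢ = trans (∑-split _) (assemble
        (trans (cong (λ t → ℓ * (t * δ v y)) (δ-≢ (x≢ ∘ sym))) (*-zeroʳ ℓ))
        (vanish {M} _ (λ { (a , b) m → cong₂ _+_ (trans (cong (δ a x *_) (δ-≢ (y≢ ∘ sym))) (*-zeroʳ (δ a x)))
                                             (cong (_* δ b y) (δ-≢ (x≢ ∘ sym))) }))
        refl)

      w-in : ∀ {x} → x ≢ v → w L x v ≡ cnt (src M) x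
      w-in {x} x≢ = trans (∑-split _) (trans (assemble
        (trans (cong (λ t → ℓ * (t * δ v v)) (δ-≢ (x≢ ∘ sym))) (*-zeroʳ ℓ))
        (trans (∑-cong M (λ { (a , b) → trans (cong₂ _+_ (trans (cong (δ a x *_) (δ-refl v)) (*-identityʳ (δ a x))) (cong (_* δ b v) (δ-≢ (x≢ ∘ sym)))) (+-identityʳ (δ a x)) }))
               (sym (∑-map proj₁ M (λ a → δ a x))))
        (vanish _ (λ { (a , b) m → trans (cong (δ a x *_) (δ-≢ (proj₂ (All.lookup avR m)))) (*-zeroʳ (δ a x)) })))
        (+-identityʳ _))

      w-out : ∀ {y} → y ≢ v → w L v y ≡ cnt (tgt M) y
      w-out {y} y≢ = trans (∑-split _) (trans (assemble
        (trans (cong (λ t → ℓ * (δ v v * t)) (δ-≢ (y≢ ∘ sym))) (trans (cong (ℓ *_) (*-zeroʳ (δ v v))) (*-zeroʳ ℓ)))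
        (trans (∑-cong M (λ { (a , b) → cong₂ _+_ (trans (cong (δ a v *_) (δ-≢ (y≢ ∘ sym))) (*-zeroʳ (δ a v))) (trans (cong (_* δ b y) (δ-refl v)) (+-identityʳ (δ b y))) }))
               (sym (∑-map proj₂ M (λ b → δ b y))))
        (vanish _ (λ { (a , b) m → cong (_* δ b y) (δ-≢ (proj₁ (All.lookup avR m))) })))
        (+-identityʳ _))

      w-loop : w L v v ≡ ℓ
      w-loop = trans (∑-split _) (trans (cong₂ _+_
        (trans (cong (ℓ *_) (cong₂ _*_ (δ-refl v) (δ-refl v))) (*-identityʳ ℓ))
        (cong₂ _+_ (vanish _ (λ { (a , b) m → cong₂ _+_ (cong (_* δ v v) (δ-≢ (proj₁ (All.lookup avM m))))
                                                       (trans (cong (δ v v *_) (δ-≢ (proj₂ (All.lookup avM m)))) (*-zeroʳ (δ v v))) }))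
                   (vanish _ (λ { (a , b) m → cong (_* δ b v) (δ-≢ (proj₁ (All.lookup avR m))) }))))
        (+-identityʳ ℓ))

      out-off : ∀ {x} → x ≢ v → out L x ≡ out (M ++ R) x
      out-off {x} x≢ = trans (∑-split _) (trans (assemble
        (trans (cong (ℓ *_) (δ-≢ (x≢ ∘ sym))) (*-zeroʳ ℓ))
        (∑-cong M (λ { (a , b) → trans (cong (δ a x +_) (δ-≢ (x≢ ∘ sym))) (+-identityʳ (δ a x)) }))
        refl) (sym (∑-++ M R _)))

      inn-off : ∀ {y} → y ≢ v → inn L y ≡ inn (M ++ R) y
      inn-off {y} y≢ = trans (∑-split _) (trans (assemble
        (trans (cong (ℓ *_) (δ-≢ (y≢ ∘ sym))) (*-zeroʳ ℓ))
        (∑-cong M (λ { (a , b) → cong (_+ δ b y) (δ-≢ (y≢ ∘ sym)) }))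
        refl) (sym (∑-++ M R _)))

      out-at : out L v ≡ length M + ℓ
      out-at = trans (∑-split _) (trans (cong₂ _+_
        (trans (cong (ℓ *_) (δ-refl v)) (*-identityʳ ℓ))
        (cong₂ _+_ (trans (∑-cong∈ M (λ { (a , b) m → cong₂ _+_ (δ-≢ (proj₁ (All.lookup avM m))) (δ-refl v) })) (trans (∑-const M 1) (*-identityʳ _)))
                   (vanish _ (λ { (a , b) m → δ-≢ (proj₁ (All.lookup avR m)) }))))
        (trans (cong (ℓ +_) (+-identityʳ (length M))) (+-comm ℓ (length M))))

      Φ-split : ∀ {U} → v ∉ U → Φ (v ∷ U) L ≡ 7 * ℓ + ∑ U (φ ∘ cnt (tgt M)) + (∑ U (φ ∘ cnt (src M)) + Φ U R)
      Φ-split {U} v∉ = cong₂ _+_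
        (cong₂ _+_ (trans (ψ-refl v _) (cong (7 *_) w-loop)) row)
        (trans (∑-+ U (λ x → ψ x v (w L x v)) (λ x → ∑ U (λ y → ψ x y (w L x y)))) (cong₂ _+_ col (∑-cong∈ U (λ x mx → ∑-cong∈ U (λ y my → cong (ψ x y) (w-off (≢v mx) (≢v my)))))))
        where
        ≢v : ∀ {x} → x ∈ U → x ≢ v
        ≢v m refl = v∉ m
        row : ∑ U (λ y → ψ v y (w L v y)) ≡ ∑ U (φ ∘ cnt (tgt M))
        row = ∑-cong∈ U (λ y m → trans (ψ-≢ _ (≢v m ∘ sym)) (cong φ (w-out (≢v m))))
        col : ∑ U (λ x → ψ x v (w L x v)) ≡ ∑ U (φ ∘ cnt (src M))
        col = ∑-cong∈ U (λ x m → trans (ψ-≢ _ (≢v m)) (cong φ (w-in (≢v m))))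

      load-split : ∀ {U} → v ∉ U → load (v ∷ U) L v ≡
                   7 * ℓ + ∑ U (φ ∘ cnt (tgt M)) + (7 * ℓ + ∑ U (φ ∘ cnt (src M)))
      load-split {U} v∉ = cong₂ _+_
        (cong₂ _+_ (trans (ψ-refl v _) (cong (7 *_) w-loop)) (∑-cong∈ U (λ y m → trans (ψ-≢ _ (≢v m ∘ sym)) (cong φ (w-out (≢v m))))))
        (cong₂ _+_ (trans (ψ-refl v _) (cong (7 *_) w-loop)) (∑-cong∈ U (λ x m → trans (ψ-≢ _ (≢v m)) (cong φ (w-in (≢v m))))))
        where
        ≢v : ∀ {x} → x ∈ U → x ≢ v
        ≢v m refl = v∉ m

  -- All that the budget argument keeps of one elimination, with the pairing hidden. Γ bounds the
  -- penalty created, and the last four fields are the regimes that the iteration distinguishes.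
  record Eliminated (k : ℕ) (U : List V) (L : List E) (v : V) : Set where
    field
      U'       : List V
      L'       : List E
      vertices : U ↭ v ∷ U'
      state    : State (100 * k) U' L'
      ℓ P Q Γ  : ℕ
      loops    : w L v v ≡ ℓ
      load≡    : load U L v ≡ 7 * ℓ + Q + (7 * ℓ + P)
      budget   : Φ U' L' + (P + Q + 7 * ℓ) ≤ Φ U L + Γ
      one-loop : ∀ {x z} → (x , x) ∈ L' → (z , z) ∈ L' → x ≡ z
      Γ≤       : Γ ≤ 7 * (100 * k)
      large    : k ≤ ℓ → Γ + 2 * k ≤ P + Q + 7 * ℓ
      small    : ℓ ≤ 15 * k → Γ ≤ P + Q + k
      looped   : ∀ {x} → ℓ ≤ k → (x , x) ∈ L' → Γ + 5 * k ≤ P + Q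
      balanced : ℓ ≡ 0 → 38 * k ≤ 10 * (P + Q) → Γ + 2 * k ≤ P + Q

  module _ {k : ℕ} (2000≤k : 2000 ≤ k) {U : List V} {L : List E} (st : State (100 * k) U L) {v : V} (v∈U : v ∈ U)
           (loops-at-v : ∀ {x} → (x , x) ∈ L → x ≡ v) where

    private
      U' : List V
      U' = proj₁ (extract v∈U)
      perm : U ↭ v ∷ U'
      perm = proj₂ (extract v∈U)
      unique-v∷U' : Unique (v ∷ U')
      unique-v∷U' = unique-↭ perm (unique st)
      uniq : Unique U'
      uniq = unique-++ʳ (v ∷ []) unique-v∷U'
      v∉ : v ∉ U'
      v∉ m = unique-disjoint (v ∷ []) unique-v∷U' (here refl) m
      U'⊆U : ∀ {x} → x ∈ U' → x ∈ U
      U'⊆U m = ∈-resp-↭ (↭-sym perm) (there m)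
      ≢v : ∀ {x} → x ∈ U' → x ≢ v
      ≢v m refl = v∉ m
      ∈U' : ∀ {x} → x ∈ U → x ≢ v → x ∈ U'
      ∈U' m ne with ∈-resp-↭ perm m
      ... | here eq = ⊥-elim (ne eq)
      ... | there m' = m'

      open Split (split v L)

      -- Each loop at v counts once in both degrees, so the loops cancel.
      degrees : length ins ≡ length outs
      degrees = +-cancelˡ-≡ ℓ _ _ (trans (trans (sym inn-v) (trans (inn≡D st v∈U) (sym (out≡D st v∈U)))) out-v)
        where
        f-out f-inn : E → ℕ
        f-out e = δ (proj₁ e) v
        f-inn e = δ (proj₂ e) v
        total-of : ∀ (f : E → ℕ) → ∑ L f ≡ ℓ * f (v , v) + (∑ ins (λ x → f (x , v)) + (∑ outs (λ y → f (v , y)) + ∑ rest f))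
        total-of f = trans (∑-↭ f eq) (trans (∑-++ (replicate ℓ (v , v)) _ f) (cong₂ _+_ (∑-replicate ℓ (v , v) f)
          (trans (∑-++ (map (_, v) ins) _ f) (cong₂ _+_ (∑-map (_, v) ins f)
            (trans (∑-++ (map (v ,_) outs) rest f) (cong (_+ ∑ rest f) (∑-map (v ,_) outs f)))))))
        zeros : ∀ {A : Set} (xs : List A) {f : A → ℕ} → (∀ x → x ∈ xs → f x ≡ 0) → ∑ xs f ≡ 0
        zeros xs h = trans (∑-cong∈ xs h) (∑-zero xs)
        ones : ∀ (xs : List V) → ∑ xs (λ _ → δ v v) ≡ length xs
        ones xs = trans (∑-const xs (δ v v)) (trans (cong (length xs *_) (δ-refl v)) (*-identityʳ _))
        inn-v : inn L v ≡ ℓ + length ins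
        inn-v = trans (total-of f-inn) (cong₂ _+_ (trans (cong (ℓ *_) (δ-refl v)) (*-identityʳ ℓ))
          (trans (cong₂ _+_ (ones ins) (cong₂ _+_ (zeros outs (λ y m → δ-≢ (All.lookup outs≢ m)))
                                                  (zeros rest (λ e m → δ-≢ (proj₂ (All.lookup rest≢ m)))))) (+-identityʳ _)))
        out-v : out L v ≡ ℓ + length outs
        out-v = trans (total-of f-out) (cong₂ _+_ (trans (cong (ℓ *_) (δ-refl v)) (*-identityʳ ℓ))
          (trans (cong₂ _+_ (zeros ins (λ x m → δ-≢ (All.lookup ins≢ m))) (trans (cong₂ _+_ (ones outs)
                   (zeros rest (λ e m → δ-≢ (proj₁ (All.lookup rest≢ m))))) (+-identityʳ _))) refl))

      Pairs : List E → Set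
      Pairs M = (L ↭ replicate ℓ (v , v) ++ expand v M ++ rest) × All (Avoids v) M

      pairs-within : ∀ {M} → Pairs M → Within U' M
      pairs-within {M} (p , av) m = ∈U' (proj₁ (within st (back (proj₁ (expand-∈ v m))))) (proj₁ (All.lookup av m)) ,
                                    ∈U' (proj₂ (within st (back (proj₂ (expand-∈ v m))))) (proj₂ (All.lookup av m))
        where
        back : ∀ {e} → e ∈ expand v M → e ∈ L
        back m = ∈-resp-↭ (↭-sym p) (∈-++⁺ʳ (replicate ℓ (v , v)) (∈-++⁺ˡ m))

      pairs-swap : ∀ {M R a b a' b'} → M ↭ (a , b) ∷ (a' , b') ∷ R → Pairs M → Pairs ((a , b') ∷ (a' , b) ∷ R)
      pairs-swap {R = R} {a} {b} {a'} {b'} q (p , av) =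
        ↭-trans p (++⁺ˡ (replicate ℓ (v , v)) (++⁺ʳ rest (↭-trans (expand-↭ v q) (expand-swap v a b a' b' R)))) , swapped (All-resp-↭ q av)
        where
        swapped : All (Avoids v) ((a , b) ∷ (a' , b') ∷ R) → All (Avoids v) ((a , b') ∷ (a' , b) ∷ R)
        swapped ((x , y) ∷ (x' , y') ∷ r) = (x , y') ∷ (x' , y) ∷ r

      start : ∃ Pairs
      start with pair-up v ins outs degrees ins≢ outs≢
      ... | M , p , av = M , ↭-trans eq (++⁺ˡ (replicate ℓ (v , v))
              (↭-trans (↭-reflexive (sym (++-assoc (map (_, v) ins) (map (v ,_) outs) rest))) (++⁺ʳ rest p))) , av

      abstract
        stable : ∃ λ M → Pairs M × Stable M rest
        stable = stabilise rest uniq Pairs pairs-within pairs-swap (proj₁ start) (proj₂ start)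

      M : List E
      M = proj₁ stable
      pm : L ↭ replicate ℓ (v , v) ++ expand v M ++ rest
      pm = proj₁ (proj₁ (proj₂ stable))
      av : All (Avoids v) M
      av = proj₂ (proj₁ (proj₂ stable))
      sM : Stable M rest
      sM = proj₂ (proj₂ stable)

      withinM : Within U' M
      withinM = pairs-within (proj₁ (proj₂ stable))

      rest⊆L : ∀ {e} → e ∈ rest → e ∈ L
      rest⊆L m = ∈-resp-↭ (↭-sym pm) (∈-++⁺ʳ (replicate ℓ (v , v)) (∈-++⁺ʳ (expand v M) m))

      within' : Within U' (M ++ rest)
      within' m with ∈-++⁻ M m
      ... | inj₁ m' = withinM m'
      ... | inj₂ m' = ∈U' (proj₁ (within st (rest⊆L m'))) (proj₁ (All.lookup rest≢ m')) ,
                      ∈U' (proj₂ (within st (rest⊆L m'))) (proj₂ (All.lookup rest≢ m'))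

      state' : State (100 * k) U' (M ++ rest)
      state' = record
        { unique = uniq
        ; within = within'
        ; out≡D = λ m → trans (sym (out-off v {ℓ} M rest pm av rest≢ (≢v m))) (out≡D st (U'⊆U m))
        ; inn≡D = λ m → trans (sym (inn-off v {ℓ} M rest pm av rest≢ (≢v m))) (inn≡D st (U'⊆U m))
        ; realizable = realizable-expand v M rest (realizable-drop v ℓ (realizable-↭ pm (realizable st))) }

      src⊆ : ∀ {x} → x ∈ src M → x ∈ U'
      src⊆ m with ∈-map⁻ proj₁ m
      ... | _ , m' , refl = proj₁ (withinM m')
      tgt⊆ : ∀ {x} → x ∈ tgt M → x ∈ U'
      tgt⊆ m with ∈-map⁻ proj₂ m
      ... | _ , m' , refl = proj₂ (withinM m')

      open Pairing uniq M rest within' (100 * k) (out≡D state') (inn≡D state') src⊆ tgt⊆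

      d+ℓ : d + ℓ ≡ 100 * k
      d+ℓ = trans (sym (out-at v {ℓ} M rest pm av rest≢)) (out≡D st v∈U)

      -- All loops of `L` sit at v, hence an edge avoiding v is no loop. Every loop left after the
      -- elimination was created by the pairing, and stability applies to it.
      loop∈M : ∀ {x} → (x , x) ∈ M ++ rest → (x , x) ∈ M
      loop∈M m with ∈-++⁻ M m
      ... | inj₁ m' = m'
      ... | inj₂ m' = ⊥-elim (proj₁ (All.lookup rest≢ m') (loops-at-v (rest⊆L m')))

      Γ₀ : ℕ
      Γ₀ = saving M rest

      eliminated : 2 * q ≤ k * k → Eliminated k U L v
      eliminated 2q≤ = record
        { U' = U' ; L' = M ++ rest ; vertices = perm ; state = state'
        ; ℓ = ℓ ; P = P ; Q = Q ; Γ = Γ₀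
        ; loops = w-loop v {ℓ} M rest pm av rest≢
        ; load≡ = trans (cong₂ _+_ (∑-↭ _ perm) (∑-↭ _ perm)) (load-split v {ℓ} M rest pm av rest≢ v∉)
        ; budget = begin
            Φ U' (M ++ rest) + (P + Q + 7 * ℓ)    ≤⟨ +-monoˡ-≤ (P + Q + 7 * ℓ) (Φ-++≤ M rest uniq withinM) ⟩
            Φ U' rest + Γ₀ + (P + Q + 7 * ℓ)      ≡⟨ lem (Φ U' rest) Γ₀ P Q (7 * ℓ) ⟩
            7 * ℓ + Q + (P + Φ U' rest) + Γ₀      ≡⟨ cong (_+ Γ₀) (sym (trans (Φ-↭ᵛ L perm) (Φ-split v {ℓ} M rest pm av rest≢ v∉))) ⟩
            Φ U L + Γ₀                            ∎
        ; one-loop = λ m m' → loops-unique sM (loop∈M m) (loop∈M m')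
        ; Γ≤ = ≤-trans (saving≤7d sM) (*-monoʳ-≤ 7 d≤100k)
        ; large = large-ℓ
        ; small = low-ℓ
        ; looped = λ h m → Estimated.looped h (loop⇒heavy sM (loop∈M m))
        ; balanced = loopless-gain }
        where
        open ≤-Reasoning
        module Estimated = Estimates k d ℓ P Q q Γ₀ 2000≤k d+ℓ 2q≤ P≤6d Q≤6d (saving≤7d sM)
                    (saving-rows sM) (saving-cols sM) (saving-crude sM) (saving-both sM)
        open Estimated using (d≤100k; large-ℓ; low-ℓ; loopless-gain)
        lem : ∀ φ₀ g p q l → φ₀ + g + (p + q + l) ≡ l + q + (p + φ₀) + g
        lem = solve-∀

    eliminate : DenseImmersion k ⊎ Eliminated k U L v
    eliminate with k * k ≤? 2 * q
    ... | no ¬le = inj₂ (eliminated (<⇒≤ (≰⇒> ¬le)))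
    ... | yes le = inj₁ (dense-between {k} {U'} {src M} {tgt M} {M ++ rest} (realizable state') uniq src⊆ tgt⊆ (|·|≤ proj₁) (|·|≤ proj₂) le)
      where
      |·|≤ : ∀ (f : E → V) → length (map f M) ≤ 100 * k
      |·|≤ f = ≤-trans (≤-reflexive (length-map f M)) (≤-trans (m≤m+n d ℓ) (≤-reflexive d+ℓ))

-- Eliminating vertices down to 200 k

module Iteration (G : Digraph) (k : ℕ) (2000≤k : 2000 ≤ k) where
  open Routing G
  open Dense G
  open Counting (Fin._≟_ {n G})
  open Bilinear (Fin._≟_ {n G})
  open Elimination G
  open State

  w≤arc+ψ : ∀ L x y → w L x y ≤ arc L x y + ψ x y (w L x y)
  w≤arc+ψ L x y with x Fin.≟ y
  ... | yes _ = m≤m+n (w L x y) (6 * w L x y)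
  ... | no _ with w L x y
  ...   | zero  = z≤n
  ...   | suc j = w≤1+φ (suc j)

  finish : ∀ {U L} → State (100 * k) U L → k ≤ length U → length U ≤ 200 * k → Φ U L ≤ 2 * k * length U → DenseImmersion k
  finish {U} {L} st k≤ ≤200k Φ≤ = dense {k} {L} {U} (realizable st) (unique st) ≤200k
      (≤-trans (*-monoʳ-≤ k k≤) (+-cancelʳ-≤ (2 * (2 * k * m)) (k * m) (2 * N) (begin
        k * m + 2 * (2 * k * m)        ≤⟨ ≤-witness {k * m + 2 * (2 * k * m)} (195 * (k * m)) (lem₁ k m) ⟩
        2 * (m * (100 * k))            ≤⟨ *-monoʳ-≤ 2 edges ⟩
        2 * (N + Φ U L)                ≡⟨ *-distribˡ-+ 2 N (Φ U L) ⟩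
        2 * N + 2 * Φ U L              ≤⟨ +-monoʳ-≤ (2 * N) (*-monoʳ-≤ 2 Φ≤) ⟩
        2 * N + 2 * (2 * k * m)        ∎)))
    where
    open ≤-Reasoning
    m = length U
    N = ∑ U (λ x → ∑ U (arc L x))
    lem₁ : ∀ k m → 2 * (m * (100 * k)) ≡ k * m + 2 * (2 * k * m) + 195 * (k * m)
    lem₁ = solve-∀
    edges : m * (100 * k) ≤ N + Φ U L
    edges = begin
      m * (100 * k)                    ≡⟨ sym (trans (∑-cong∈ U (λ x mx → trans (∑-w-row L (unique st) (within st) x) (out≡D st mx))) (∑-const U (100 * k))) ⟩
      ∑ U (λ x → ∑ U (w L x))          ≤⟨ ∑-mono U (λ x → ∑-mono U (w≤arc+ψ L x)) ⟩
      ∑ U (λ x → ∑ U (λ y → arc L x y + ψ x y (w L x y)))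
                                       ≡⟨ ∑∑-+ U U (arc L) (λ x y → ψ x y (w L x y)) ⟩
      N + Φ U L                        ∎

  ∑-load : ∀ U L → ∑ U (load U L) ≡ 2 * Φ U L
  ∑-load U L = trans (∑-+ U (λ v → ∑ U (λ y → ψ v y (w L v y))) (λ v → ∑ U (λ x → ψ x v (w L x v))))
    (trans (cong (Φ U L +_) (∑-comm U U (λ v x → ψ x v (w L x v)))) (cong (Φ U L +_) (sym (+-identityʳ _))))

  Loopless : List E → Set
  Loopless L = ∀ {x} → (x , x) ∉ L

  -- Only the last elimination can have created loops, all at a single vertex, which is eliminated next.
  Admissible : ℕ → List V → List E → Set
  Admissible m U L = (Loopless L × Φ U L ≤ 2 * k * m)
                   ⊎ (∃ λ u → u ∈ U × (∀ {x} → (x , x) ∈ L → x ≡ u) × Φ U L + 3 * k ≤ 2 * k * m)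

  private
    budget-step : ∀ {a b c g t} → a + c ≤ b + g → g + t ≤ c → a + t ≤ b
    budget-step {a} {b} {c} {g} {t} h h' = +-cancelʳ-≤ (c + g) (a + t) b (begin
      a + t + (c + g)   ≡⟨ lem a t c g ⟩
      a + c + (g + t)   ≤⟨ +-mono-≤ h h' ⟩
      b + g + c         ≡⟨ lem' b g c ⟩
      b + (c + g)       ∎)
      where
      open ≤-Reasoning
      lem : ∀ a t c g → a + t + (c + g) ≡ a + c + (g + t)
      lem = solve-∀
      lem' : ∀ b g c → b + g + c ≡ b + (c + g)
      lem' = solve-∀

    minus-2k : ∀ {a} m → a + 2 * k ≤ 2 * k * suc m → a ≤ 2 * k * m
    minus-2k {a} m h = +-cancelʳ-≤ (2 * k) a (2 * k * m) (≤-trans h (≤-reflexive (trans (*-suc (2 * k) m) (+-comm (2 * k) _))))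

  -- The margin 2 k is the budget of the lost vertex; if a loop was created, another 3 k is set
  -- aside as a reserve.
  admissible : ∀ {m U L} v (e : Eliminated k U L v) → let open Eliminated e in
    Φ U' L' + 2 * k ≤ 2 * k * suc m →
    (∀ {x} → (x , x) ∈ L' → Φ U' L' + 5 * k ≤ 2 * k * suc m) →
    Admissible m U' L'
  admissible {m} v e b₂ b₅ with any? (λ e' → proj₁ e' Fin.≟ proj₂ e') (Eliminated.L' e)
  ... | no none = inj₁ ((λ loop → none (lose loop refl)) , minus-2k m b₂)
  ... | yes some with find some
  ...   | (x , .x) , loop , refl = inj₂ (x , proj₁ (within (Eliminated.state e) loop) , (λ loop' → Eliminated.one-loop e loop' loop) ,
            minus-2k m (≤-trans (≤-reflexive (lem (Φ (Eliminated.U' e) (Eliminated.L' e)) k)) (b₅ loop)))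
    where
    lem : ∀ a k → a + 3 * k + 2 * k ≡ a + 5 * k
    lem = solve-∀

  -- The reserve 3 k is spent here. With ℓ ≤ k the penalty may rise by k, and 2 k is due for the
  -- lost vertex. If a new loop appears, the reserve must be restored: by the gain 5 k of `looped`,
  -- or, for ℓ ≥ k, by the gain 2 k of `large` together with the old reserve.
  after-special : ∀ {m U L} u (e : Eliminated k U L u) → Φ U L + 3 * k ≤ 2 * k * suc m →
                  Admissible m (Eliminated.U' e) (Eliminated.L' e)
  after-special {m} {U} {L} u e b = admissible u e no-loop loop
    where
    open Eliminated e
    from-drop : ∀ {a} → a + 2 * k ≤ Φ U L → a + 5 * k ≤ 2 * k * suc m
    from-drop {a} h = ≤-trans (≤-reflexive (lem a k)) (≤-trans (+-monoˡ-≤ (3 * k) h) b)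
      where
      lem : ∀ a k → a + 5 * k ≡ a + 2 * k + 3 * k
      lem = solve-∀
    weaken : ∀ {P' Q'} → Γ ≤ P' + Q' + k → Φ U' L' + (P' + Q') ≤ Φ U L + Γ → Φ U' L' ≤ Φ U L + k
    weaken {P'} {Q'} h h' = +-cancelʳ-≤ (P' + Q') (Φ U' L') (Φ U L + k) (≤-trans h' (≤-trans (+-monoʳ-≤ (Φ U L) h) (≤-reflexive (lem (Φ U L) (P' + Q') k))))
      where
      lem : ∀ a s k → a + (s + k) ≡ a + k + s
      lem = solve-∀
    budget' : Φ U' L' + (P + Q) ≤ Φ U L + Γ
    budget' = ≤-trans (+-monoʳ-≤ (Φ U' L') (m≤m+n (P + Q) (7 * ℓ))) budget
    no-loop : Φ U' L' + 2 * k ≤ 2 * k * suc m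
    no-loop with ≤-total k ℓ
    ... | inj₁ k≤ℓ = ≤-trans (budget-step {Φ U' L'} budget (large k≤ℓ)) (≤-trans (m≤m+n (Φ U L) (3 * k)) b)
    ... | inj₂ ℓ≤k = ≤-trans (+-monoˡ-≤ (2 * k) (weaken {P} {Q} (small (≤-trans ℓ≤k (m≤m+n k (14 * k)))) budget'))
                             (≤-trans (≤-reflexive (lem (Φ U L) k)) b)
      where
      lem : ∀ a k → a + k + 2 * k ≡ a + 3 * k
      lem = solve-∀
    loop : ∀ {x} → (x , x) ∈ L' → Φ U' L' + 5 * k ≤ 2 * k * suc m
    loop lp with ≤-total k ℓ
    ... | inj₁ k≤ℓ = from-drop {Φ U' L'} (budget-step {Φ U' L'} budget (large k≤ℓ))
    ... | inj₂ ℓ≤k = ≤-trans (budget-step {Φ U' L'} budget' (looped ℓ≤k lp)) (≤-trans (m≤m+n (Φ U L) (3 * k)) b)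

  no-loops⇒w≡0 : ∀ {L} v → Loopless L → w L v v ≡ 0
  no-loops⇒w≡0 {L} v none = n<1⇒n≡0 (≰⇒> (λ le → none (w-≥1⁻ L le)))

  after-heavy : ∀ {m U L} v (e : Eliminated k U L v) → Loopless L → 38 * k ≤ 10 * load U L v → Φ U L ≤ 2 * k * suc m →
                Admissible m (Eliminated.U' e) (Eliminated.L' e)
  after-heavy {m} {U} {L} v e none heavy b = admissible v e
      (≤-trans (budget-step {Φ U' L'} budget' (balanced ℓ≡0 heavy')) b)
      (λ lp → ≤-trans (budget-step {Φ U' L'} budget' (looped (≤-trans (≤-reflexive ℓ≡0) z≤n) lp)) b)
    where
    open Eliminated e
    ℓ≡0 : ℓ ≡ 0
    ℓ≡0 = trans (sym loops) (no-loops⇒w≡0 {L} v none)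
    budget' : Φ U' L' + (P + Q) ≤ Φ U L + Γ
    budget' = ≤-trans (+-monoʳ-≤ (Φ U' L') (m≤m+n (P + Q) (7 * ℓ))) budget
    heavy' : 38 * k ≤ 10 * (P + Q)
    heavy' = ≤-trans heavy (≤-reflexive (cong (10 *_) (trans load≡
      (trans (cong (λ t → 7 * t + Q + (7 * t + P)) ℓ≡0) (+-comm Q P)))))

  after-light : ∀ {m U L} v (e : Eliminated k U L v) → length U ≡ suc m → 200 * k ≤ suc m →
                (∀ {x} → x ∈ U → 10 * load U L x ≤ 38 * k) → Admissible m (Eliminated.U' e) (Eliminated.L' e)
  after-light {m} {U} {L} v e len big light = admissible v e (≤-trans (+-monoʳ-≤ (Φ U' L') (*-monoˡ-≤ k (m≤m+n 2 3))) bound) (λ _ → bound)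
    where
    open Eliminated e
    open ≤-Reasoning
    20Φ≤ : 20 * Φ U L ≤ 38 * (k * suc m)
    20Φ≤ = begin
      20 * Φ U L                  ≡⟨ *-assoc 10 2 (Φ U L) ⟩
      10 * (2 * Φ U L)            ≡⟨ cong (10 *_) (sym (∑-load U L)) ⟩
      10 * ∑ U (load U L)         ≡⟨ sym (∑-*ˡ U 10 (load U L)) ⟩
      ∑ U (λ x → 10 * load U L x) ≤⟨ ∑-mono∈ U (λ x mx → light mx) ⟩
      ∑ U (λ _ → 38 * k)          ≡⟨ trans (∑-const U (38 * k)) (cong (_* (38 * k)) len) ⟩
      suc m * (38 * k)            ≡⟨ lem (suc m) k ⟩
      38 * (k * suc m)            ∎
      where
      lem : ∀ m k → m * (38 * k) ≡ 38 * (k * m)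
      lem = solve-∀
    7050≤m : 7050 ≤ suc m
    7050≤m = ≤-trans (m≤m+n 7050 392950) (≤-trans (*-monoʳ-≤ 200 2000≤k) big)
    bound : Φ U' L' + 5 * k ≤ 2 * k * suc m
    bound = *-cancelˡ-≤ 20 (begin
      20 * (Φ U' L' + 5 * k)                  ≤⟨ *-monoʳ-≤ 20 (+-monoˡ-≤ (5 * k) (≤-trans (m≤m+n (Φ U' L') (P + Q + 7 * ℓ)) (≤-trans budget (+-monoʳ-≤ (Φ U L) Γ≤)))) ⟩
      20 * (Φ U L + 7 * (100 * k) + 5 * k)    ≡⟨ lem₁ (Φ U L) k ⟩
      20 * Φ U L + 2 * (k * 7050)             ≤⟨ +-mono-≤ 20Φ≤ (*-monoʳ-≤ 2 (*-monoʳ-≤ k 7050≤m)) ⟩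
      38 * (k * suc m) + 2 * (k * suc m)      ≡⟨ lem₂ k (suc m) ⟩
      20 * (2 * k * suc m)                    ∎)
      where
      lem₁ : ∀ a k → 20 * (a + 7 * (100 * k) + 5 * k) ≡ 20 * a + 2 * (k * 7050)
      lem₁ = solve-∀
      lem₂ : ∀ k m → 38 * (k * m) + 2 * (k * m) ≡ 20 * (2 * k * m)
      lem₂ = solve-∀

  iterate : ∀ m {U L} → length U ≡ m → k ≤ m → State (100 * k) U L → Admissible m U L → DenseImmersion k
  continue : ∀ m {U L v} → length U ≡ suc m → 200 * k ≤ suc m → (e : Eliminated k U L v) →
             Admissible m (Eliminated.U' e) (Eliminated.L' e) → 200 * k ≤ m → DenseImmersion k

  continue m len big e adm 200k≤m = iterate m (suc-injective (trans (sym (↭-length (Eliminated.vertices e))) len))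
    (≤-trans (m≤m+n k (199 * k)) 200k≤m) (Eliminated.state e) adm

  iterate m {U} {L} len k≤m st adm with length U ≤? 200 * k
  ... | yes small = finish st (subst (k ≤_) (sym len) k≤m) small (subst (λ t → Φ U L ≤ 2 * k * t) (sym len) (Φ≤ adm))
    where
    Φ≤ : Admissible m U L → Φ U L ≤ 2 * k * m
    Φ≤ (inj₁ (_ , b)) = b
    Φ≤ (inj₂ (_ , _ , _ , b)) = ≤-trans (m≤m+n (Φ U L) (3 * k)) b
  iterate zero {[]} len k≤m st adm | no ¬small = ⊥-elim (¬small z≤n)
  iterate (suc m) {U} {L} len k≤m st (inj₂ (u , u∈ , at-u , b)) | no ¬small =
    [ (λ h → h) , (λ e → continue m len (<⇒≤ big) e (after-special u e b) (s≤s⁻¹ big)) ]′ (eliminate 2000≤k st u∈ at-u)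
    where
    big : 200 * k < suc m
    big = subst (200 * k <_) len (≰⇒> ¬small)
  iterate (suc m) {u ∷ U} {L} len k≤m st (inj₁ (none , b)) | no ¬small with any? (λ v → 38 * k ≤? 10 * load (u ∷ U) L v) (u ∷ U)
  ... | yes some = [ (λ h → h) , (λ e → continue m len (<⇒≤ big) e (after-heavy v e none (proj₂ (proj₂ (find some))) b) (s≤s⁻¹ big)) ]′
                     (eliminate 2000≤k st (proj₁ (proj₂ (find some))) (λ lp → ⊥-elim (none lp)))
    where
    v = proj₁ (find some)
    big : 200 * k < suc m
    big = subst (200 * k <_) len (≰⇒> ¬small)
  ... | no all-light = [ (λ h → h) , (λ e → continue m len (<⇒≤ big) e
                           (after-light u e len (<⇒≤ big) (λ mx → <⇒≤ (≰⇒> (λ le → all-light (lose mx le))))) (s≤s⁻¹ big)) ]′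
                         (eliminate 2000≤k st (here refl) (λ lp → ⊥-elim (none lp)))
    where
    big : 200 * k < suc m
    big = subst (200 * k <_) len (≰⇒> ¬small)

-- Reduction to regular digraphs

∈-take : ∀ {A : Set} m {xs : List A} {x} → x ∈ take m xs → x ∈ xs
∈-take (suc m) {_ ∷ _} (here eq) = here eq
∈-take (suc m) {_ ∷ _} (there i) = there (∈-take m i)

countT≡∑-tabulate : ∀ {A : Set} {m} (f : Fin m → A) (h : A → ℕ) (b : Fin m → Bool) →
                    (∀ i → (if b i then 1 else 0) ≡ h (f i)) → countT b ≡ ∑ (tabulate f) h
countT≡∑-tabulate {m = zero}  f h b eq = refl
countT≡∑-tabulate {m = suc m} f h b eq = cong₂ _+_ (eq zero) (countT≡∑-tabulate (f ∘ suc) h (b ∘ suc) (eq ∘ suc))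

∑≤length-filter : ∀ {A : Set} {P : A → Set} (P? : Decidable P) xs {f : A → ℕ} → (∀ x → f x ≤ 1) → (∀ x → ¬ P x → f x ≡ 0) →
                  ∑ xs f ≤ length (filter P? xs)
∑≤length-filter P? xs {f} ≤1 zero-off = ≤-trans (≤-reflexive (∑-filter P? xs zero-off))
  (≤-trans (∑-mono (filter P? xs) ≤1) (≤-reflexive (trans (∑-const (filter P? xs) 1) (*-identityʳ _))))

module Regularise (G : Digraph) (k : ℕ) (2000≤k : 2000 ≤ k) where
  open Routing G
  open Dense G
  open Counting (Fin._≟_ {n G})
  open Bilinear (Fin._≟_ {n G})
  open Elimination G
  open Iteration G k 2000≤k

  open import Data.List.Membership.DecPropositional (≡-dec (Fin._≟_ {n G}) (Fin._≟_ {n G})) using (_∈?_)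

  all : List V
  all = allFin (n G)

  cnt-∉ : ∀ xs {x} → x ∉ xs → cnt xs x ≡ 0
  cnt-∉ []       x∉ = refl
  cnt-∉ (a ∷ xs) x∉ = cong₂ _+_ (δ-≢ (λ eq → x∉ (here (sym eq)))) (cnt-∉ xs (x∉ ∘ there))

  cnt≤1 : ∀ {xs} x → Unique xs → cnt xs x ≤ 1
  cnt≤1 {[]}     x u = z≤n
  cnt≤1 {a ∷ xs} x (a∉ ∷ u) with a Fin.≟ x
  ... | yes refl = s≤s (≤-reflexive (cnt-∉ xs (λ m → All.lookup a∉ m refl)))
  ... | no _     = cnt≤1 x u

  cnt≤pos : ∀ {xs} x → Unique xs → cnt xs x ≤ pos (cnt xs x)
  cnt≤pos {xs} x u with cnt xs x | cnt≤1 x u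
  ... | zero  | _ = z≤n
  ... | suc _ | h = h

  w-∉ : ∀ L {x y} → (x , y) ∉ L → w L x y ≡ 0
  w-∉ L x∉ = n<1⇒n≡0 (≰⇒> (x∉ ∘ w-≥1⁻ L))

  w≤1 : ∀ {L} x y → Unique L → w L x y ≤ 1
  w≤1 {[]} x y u = z≤n
  w≤1 {(a , b) ∷ L} x y (e∉ ∷ u) with a Fin.≟ x | b Fin.≟ y
  ... | yes refl | yes refl = s≤s (≤-reflexive (w-∉ L (λ m → All.lookup e∉ m refl)))
  ... | yes _    | no _     = w≤1 x y u
  ... | no _     | _        = w≤1 x y u

  record Simple (L : List E) : Set where
    field
      unique     : Unique L
      none       : Loopless L
      balanced   : ∀ x → out L x ≡ inn L x
      degree     : ∀ x → 100 * k ≤ out L x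
      realizable : Realizable L
  open Simple

  within-all : ∀ {L} → Within all L
  within-all {_} {a} {b} _ = ∈-allFin a , ∈-allFin b

  k≤100k : k ≤ 100 * k
  k≤100k = m≤m+n k (99 * k)

  regular : ∀ {L} → Simple L → 0 < n G → (∀ x → out L x ≤ 100 * k) → DenseImmersion k
  regular {L} si 0<n out≤ = iterate (length all) refl k≤n record
      { unique = allFin⁺ (n G) ; within = within-all {L} ; out≡D = λ {x} _ → out≡ x
      ; inn≡D = λ {x} _ → trans (sym (balanced si x)) (out≡ x) ; realizable = realizable si }
      (inj₁ (none si , ≤-trans (≤-reflexive Φ≡0) z≤n))
    where
    open ≤-Reasoning
    out≡ : ∀ x → out L x ≡ 100 * k
    out≡ x = ≤-antisym (out≤ x) (degree si x)
    v : V
    v = fromℕ< 0<n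
    k≤n : k ≤ length all
    k≤n = begin
      k                     ≤⟨ k≤100k ⟩
      100 * k               ≤⟨ degree si v ⟩
      out L v               ≡⟨ sym (∑-w-row L (allFin⁺ (n G)) (within-all {L}) v) ⟩
      ∑ all (w L v)         ≤⟨ ∑-mono all (λ y → w≤1 v y (unique si)) ⟩
      ∑ all (λ _ → 1)       ≡⟨ trans (∑-const all 1) (*-identityʳ (length all)) ⟩
      length all            ∎
    Φ≡0 : Φ all L ≡ 0
    Φ≡0 = trans (∑-cong all (λ x → trans (∑-cong all (λ y → point x y)) (∑-zero all))) (∑-zero all)
      where
      φ-≤1 : ∀ {t} → t ≤ 1 → φ t ≡ 0
      φ-≤1 {zero} _ = refl
      φ-≤1 {suc zero} _ = refl
      φ-≤1 {suc (suc t)} (s≤s ())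
      point : ∀ x y → ψ x y (w L x y) ≡ 0
      point x y with x Fin.≟ y
      ... | yes refl = cong (7 *_) (w-∉ L (none si))
      ... | no _ = φ-≤1 (w≤1 x y (unique si))

  -- The last two conditions keep the list free of loops and parallel edges after the lift.
  Liftable : List E → E → E → Set
  Liftable L (x , z) (z' , y) = 100 * k < out L z × z ≡ z' × x ≢ y × (x , y) ∉ L

  liftable? : ∀ L e e' → Dec (Liftable L e e')
  liftable? L (x , z) (z' , y) = (100 * k <? out L z) ×-dec ((z Fin.≟ z') ×-dec (¬? (x Fin.≟ y) ×-dec ¬? ((x , y) ∈? L)))

  -- Only z changes degree, losing one edge in and one out, and its excess permits this.
  lifted : ∀ {L x y z} → Simple L → (x , z) ∈ L → (z , y) ∈ L → 100 * k < out L z → x ≢ y → (x , y) ∉ L →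
           ∃ λ L' → Simple L' × length L' < length L
  lifted {L} {x} {y} {z} si m m' big x≢y xy∉ = (x , y) ∷ R , record
      { unique = All.tabulate (λ mr eq → xy∉ (∈-resp-↭ (↭-sym p) (there (there (subst (_∈ R) (sym eq) mr))))) ∷ unique-++ʳ ((x , z) ∷ (z , y) ∷ []) (unique-↭ p (unique si))
      ; none = λ { (here refl) → x≢y refl ; (there mr) → none si (∈-resp-↭ (↭-sym p) (there (there mr))) }
      ; balanced = λ t → +-cancelˡ-≡ (δ z t) _ _ (trans (sym (out-eq t)) (trans (balanced si t) (inn-eq t)))
      ; degree = λ t → +-cancelˡ-≤ (δ z t) _ _ (≤-trans (deg t) (≤-reflexive (out-eq t)))
      ; realizable = realizable-lift (realizable-↭ p (realizable si)) } ,
      ≤-reflexive (sym (↭-length p))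
    where
    R₁ = proj₁ (extract m)
    p₁ : L ↭ (x , z) ∷ R₁
    p₁ = proj₂ (extract m)
    m'' : (z , y) ∈ R₁
    m'' with ∈-resp-↭ p₁ m'
    ... | here refl = ⊥-elim (none si m)
    ... | there t = t
    R = proj₁ (extract m'')
    p : L ↭ (x , z) ∷ (z , y) ∷ R
    p = ↭-trans p₁ (prep _ (proj₂ (extract m'')))
    out-eq : ∀ t → out L t ≡ δ z t + out ((x , y) ∷ R) t
    out-eq t = trans (∑-↭ _ p) (lem (δ x t) (δ z t) (out R t))
      where
      lem : ∀ a b c → a + (b + c) ≡ b + (a + c)
      lem = solve-∀
    inn-eq : ∀ t → inn L t ≡ δ z t + inn ((x , y) ∷ R) t
    inn-eq t = ∑-↭ _ p
    deg : ∀ t → δ z t + 100 * k ≤ out L t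
    deg t with z Fin.≟ t
    ... | yes refl = big
    ... | no _ = degree si t

  -- Take k in-neighbours and k out-neighbours of z. Of the k k pairs at most k are diagonal, and
  -- twice the remaining number is at least k k because k ≥ 2.
  complete : ∀ {L z} → Simple L → 100 * k < out L z → (∀ {x y} → (x , z) ∈ L → (z , y) ∈ L → x ≢ y → (x , y) ∈ L) → DenseImmersion k
  complete {L} {z} si big full = dense-between {k} {all} {X} {Y} {L} (realizable si) (allFin⁺ (n G)) (λ {x} _ → ∈-allFin x) (λ {y} _ → ∈-allFin y)
      (≤-trans (≤-reflexive |X|) k≤100k) (≤-trans (≤-reflexive |Y|) k≤100k)
      (+-cancelʳ-≤ (2 * k) (k * k) (2 * q) (begin
        k * k + 2 * k             ≤⟨ +-monoʳ-≤ (k * k) (*-monoˡ-≤ k (≤-trans (m≤m+n 2 1998) 2000≤k)) ⟩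
        k * k + k * k             ≡⟨ cong (k * k +_) (sym (+-identityʳ (k * k))) ⟩
        2 * (k * k)               ≤⟨ *-monoʳ-≤ 2 pairs ⟩
        2 * (q + k)               ≡⟨ *-distribˡ-+ 2 q k ⟩
        2 * q + 2 * k             ∎))
    where
    open ≤-Reasoning
    X₀ Y₀ X Y : List V
    X₀ = filter (λ x → (x , z) ∈? L) all
    Y₀ = filter (λ y → (z , y) ∈? L) all
    X = take k X₀
    Y = take k Y₀
    uX : Unique X
    uX = take⁺ k (filter⁺ (λ x → (x , z) ∈? L) (allFin⁺ (n G)))
    uY : Unique Y
    uY = take⁺ k (filter⁺ (λ y → (z , y) ∈? L) (allFin⁺ (n G)))
    k≤out : k ≤ out L z
    k≤out = ≤-trans k≤100k (<⇒≤ big)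
    |X| : length X ≡ k
    |X| = trans (length-take k X₀) (m≤n⇒m⊓n≡m (≤-trans k≤out (≤-trans (≤-reflexive (trans (balanced si z) (sym (∑-w-col L (allFin⁺ (n G)) (within-all {L}) z))))
            (∑≤length-filter (λ x → (x , z) ∈? L) all (λ x → w≤1 x z (unique si)) (λ x x∉ → w-∉ L x∉)))))
    |Y| : length Y ≡ k
    |Y| = trans (length-take k Y₀) (m≤n⇒m⊓n≡m (≤-trans k≤out (≤-trans (≤-reflexive (sym (∑-w-row L (allFin⁺ (n G)) (within-all {L}) z)))
            (∑≤length-filter (λ y → (z , y) ∈? L) all (λ y → w≤1 z y (unique si)) (λ y y∉ → w-∉ L y∉)))))
    q = arcs-between all X Y L
    near : ∀ {x y} → x ∈ X → y ∈ Y → 1 ≤ arc L x y + δ x y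
    near {x} {y} mx my with x Fin.≟ y
    ... | yes _ = ≤-refl
    ... | no x≢y with w L x y | w-≥1 {L} (full (proj₂ (∈-filter⁻ (λ x → (x , z) ∈? L) {xs = all} (∈-take k mx)))
                                               (proj₂ (∈-filter⁻ (λ y → (z , y) ∈? L) {xs = all} (∈-take k my))) x≢y)
    ...   | suc _ | _ = ≤-refl
    diagonal : ∑ X (λ x → ∑ Y (δ x)) ≤ k
    diagonal = begin
      ∑ X (λ x → ∑ Y (δ x))   ≤⟨ ∑-mono X (λ x → ≤-trans (≤-reflexive (∑-cong Y (λ y → δ-sym x y))) (cnt≤1 x uY)) ⟩
      ∑ X (λ _ → 1)           ≡⟨ trans (∑-const X 1) (trans (*-identityʳ (length X)) |X|) ⟩
      k                       ∎
    arcs : ∑ X (λ x → ∑ Y (arc L x)) ≤ q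
    arcs = begin
      ∑ X (λ x → ∑ Y (arc L x))
        ≡⟨ sym (∑-cnt X (λ x → ∑ Y (arc L x)) (allFin⁺ (n G)) (λ {x} _ → ∈-allFin x)) ⟩
      ∑ all (λ x → cnt X x * ∑ Y (arc L x))
        ≡⟨ ∑-cong all (λ x → trans (cong (cnt X x *_) (sym (∑-cnt Y (arc L x) (allFin⁺ (n G)) (λ {y} _ → ∈-allFin y))))
                                   (sym (∑-*ˡ all (cnt X x) (λ y → cnt Y y * arc L x y)))) ⟩
      ∑ all (λ x → ∑ all (λ y → cnt X x * (cnt Y y * arc L x y)))
        ≤⟨ ∑-mono all (λ x → ∑-mono all (λ y → *-mono-≤ (cnt≤pos x uX) (*-monoˡ-≤ (arc L x y) (cnt≤pos y uY)))) ⟩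
      q ∎
    pairs : k * k ≤ q + k
    pairs = begin
      k * k                                       ≡⟨ cong₂ _*_ (sym |X|) (sym |Y|) ⟩
      length X * length Y                         ≡⟨ cong (length X *_) (sym (trans (∑-const Y 1) (*-identityʳ (length Y)))) ⟩
      length X * ∑ Y (λ _ → 1)                    ≡⟨ sym (∑-const X (∑ Y (λ _ → 1))) ⟩
      ∑ X (λ x → ∑ Y (λ _ → 1))                   ≤⟨ ∑-mono∈ X (λ x mx → ∑-mono∈ Y (λ y my → near mx my)) ⟩
      ∑ X (λ x → ∑ Y (λ y → arc L x y + δ x y))   ≡⟨ trans (∑-cong X (λ x → ∑-+ Y (arc L x) (δ x))) (∑-+ X (λ x → ∑ Y (arc L x)) (λ x → ∑ Y (δ x))) ⟩
      ∑ X (λ x → ∑ Y (arc L x)) + ∑ X (λ x → ∑ Y (δ x)) ≤⟨ +-mono-≤ arcs diagonal ⟩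
      q + k                                       ∎

  regularise : ∀ {L} → 0 < n G → Simple L → Acc _<_ (length L) → DenseImmersion k
  regularise {L} 0<n si (acc rec) with any? (λ e → any? (liftable? L e) L) L
  ... | yes some = let (_ , m , some') = find some
                       ((_ , y) , m' , big , z≡ , x≢y , xy∉) = find some'
                       (_ , si' , shorter) = lifted si m (subst (λ t → (t , y) ∈ L) (sym z≡) m') big x≢y xy∉
                   in regularise 0<n si' (rec shorter)
  ... | no stuck with any? (λ z → 100 * k <? out L z) all
  ...   | yes some = let (z , _ , big) = find some in complete si big (λ m m' x≢y → covered m m' x≢y big)
    where
    covered : ∀ {x y z} → (x , z) ∈ L → (z , y) ∈ L → x ≢ y → 100 * k < out L z → (x , y) ∈ L
    covered {x} {y} m m' x≢y big with (x , y) ∈? L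
    ... | yes i = i
    ... | no xy∉ = ⊥-elim (stuck (lose m (lose m' (big , refl , x≢y , xy∉))))
  ...   | no none-big = regular si 0<n (λ x → ≮⇒≥ (λ big → none-big (lose (∈-allFin x) big)))

  edge? : ∀ (e : E) → Dec (adj G (proj₁ e) (proj₂ e) ≡ true)
  edge? (x , y) = adj G x y Bool.≟ true

  edges : List E
  edges = filter edge? (cartesianProduct all all)

  edges-unique : Unique edges
  edges-unique = filter⁺ edge? (cartesianProduct⁺ (allFin⁺ (n G)) (allFin⁺ (n G)))

  edges⇒adj : ∀ {x y} → (x , y) ∈ edges → adj G x y ≡ true
  edges⇒adj m = proj₂ (∈-filter⁻ edge? {xs = cartesianProduct all all} m)

  w-edges : ∀ x y → (if adj G x y then 1 else 0) ≡ w edges x y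
  w-edges x y with adj G x y in eq
  ... | true  = ≤-antisym (w-≥1 {edges} (∈-filter⁺ edge? (∈-cartesianProduct⁺ (∈-allFin x) (∈-allFin y)) eq)) (w≤1 x y edges-unique)
  ... | false = sym (w-∉ edges (λ m → contra (trans (sym eq) (edges⇒adj m))))
    where
    contra : ¬ (false ≡ true)
    contra ()

  out-edges : ∀ x → outdeg G x ≡ out edges x
  out-edges x = trans (countT≡∑-tabulate id (w edges x) (adj G x) (w-edges x)) (∑-w-row edges (allFin⁺ (n G)) (within-all {edges}) x)

  inn-edges : ∀ x → indeg G x ≡ inn edges x
  inn-edges x = trans (countT≡∑-tabulate id (λ y → w edges y x) (λ y → adj G y x) (λ y → w-edges y x)) (∑-w-col edges (allFin⁺ (n G)) (within-all {edges}) x)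

  edge-threads : ∀ {L} → (∀ {x y} → (x , y) ∈ L → adj G x y ≡ true) → Threads L L
  edge-threads {[]}    h = []
  edge-threads {_ ∷ L} h = step (h (here refl)) stop ∷ edge-threads (h ∘ there)

  initial : Eulerian G → (∀ v → 100 * k ≤ outdeg G v) → Simple edges
  initial eul deg = record
    { unique = edges-unique
    ; none = λ {x} m → contra (trans (sym (loopless G x)) (edges⇒adj m))
    ; balanced = λ x → trans (sym (out-edges x)) (trans (sym (eul x)) (inn-edges x))
    ; degree = λ x → ≤-trans (deg x) (≤-reflexive (out-edges x))
    ; realizable = edges , edge-threads edges⇒adj , edges-unique }
    where
    contra : ¬ (false ≡ true)
    contra ()

  dense-immersion : 0 < n G → Eulerian G → (∀ v → 100 * k ≤ outdeg G v) → DenseImmersion k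
  dense-immersion 0<n eul deg = regularise 0<n (initial eul deg) (<-wellFounded _)

theorem4p3 : Σ ℕ λ β → 0 < β × Σ ℕ λ K → ∀ k → K ≤ k →
    (G : Digraph) → 0 < n G → Eulerian G →
    (∀ v → 100 * k ≤ indeg G v) → (∀ v → 100 * k ≤ outdeg G v) →
    Σ Digraph λ H → n H ≤ β * k × k * k ≤ 2 * edgeCount H × Immerses G H
theorem4p3 = 200 , s≤s z≤n , 2000 , λ k 2000≤k G 0<n eul _ deg →
  Regularise.dense-immersion G k 2000≤k 0<n eul deg
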